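{- Let $M$ be a countable transitive model of a sufficient fragment of $\mathsf{ZFC}$. There is a poset $\mathbb{P}\in M$ that is not weakly homogeneous (in $M$), but for which the equivalence relation $\equiv_M^{\mathbb{P}}$ on $\operatorname{Gen}(M,\mathbb{P})$ is not smooth.
   Context: $\operatorname{Gen}(M,\mathbb{P})$ is the Polish space of $M$-generic filters for $\mathbb{P}$, with basis the clopen sets $N_p=\{G\in\operatorname{Gen}(M,\mathbb{P}) : p\in G\}$, $p\in\mathbb{P}$. The relation $\equiv_M^{\mathbb{P}}$ on $\operatorname{Gen}(M,\mathbb{P})$ is defined by $G\equiv_M^{\mathbb{P}}H \iff M[G]=M[H]$; it is a countable Borel equivalence relation. A Borel equivalence relation is smooth if it is Borel reducible to equality on a standard Borel space. A poset $\mathbb{P}$ is weakly homogeneous if for all pairs of conditions $q,r\in\mathbb{P}$ there is an automorphism $e\colon\mathbb{P}\to\mathbb{P}$ such that $e(q)$ is compatible with $r$. -}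

module Defs where

open import Level using (0ℓ) renaming (suc to lsuc)
open import Data.Bool.Base using (Bool; true; false)
open import Data.Empty using (⊥)
open import Data.Fin.Base using (Fin; zero; suc; lift; _↑ʳ_)
open import Data.Fin.Patterns using (0F; 1F; 2F; 3F)
open import Data.Maybe.Base using (Maybe; just)
open import Data.Nat.Base as ℕ using (ℕ; zero; suc)
open import Data.Product.Base using (Σ-syntax; ∃-syntax; _×_; _,_; proj₁; proj₂)
open import Data.Rational.Base using (ℚ; 0ℚ; _<_; _+_)
open import Data.Sum.Base using (_⊎_)
open import Data.Vec.Functional using ([]; _∷_)
open import Function.Base using (_∘_)
open import Function.Bundles using (Func; _⇔_)
open import Relation.Binary.Bundles using (Setoid)
open import Relation.Binary.Core using (Rel)
open import Relation.Binary.PropositionalEquality.Core using (_≡_)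
open import Relation.Nullary.Negation.Core using (¬_)
open import Relation.Unary using (Pred; ∁; ⋃) renaming (_≐_ to _≐ₚ_)

------------------------------------------------------------------------
-- The background universe of sets: Aczel's well-founded trees up to
-- extensional equality.

data V : Set₁ where
  sup : (A : Set) → (A → V) → V

Index : V → Set
Index (sup A f) = A

elem : (x : V) → Index x → V
elem (sup A f) = f

infix 4 _≈_ _∈_ _⊆_

_≈_ : V → V → Set
sup A f ≈ sup B g = (∀ a → ∃[ b ] f a ≈ g b) × (∀ b → ∃[ a ] f a ≈ g b)

_∈_ : V → V → Set
x ∈ y = ∃[ i ] x ≈ elem y i

_⊆_ : V → V → Set₁
x ⊆ y = ∀ z → z ∈ x → z ∈ y

≈-refl : ∀ {x} → x ≈ x
≈-refl {sup A f} = (λ a → a , ≈-refl) , (λ a → a , ≈-refl)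

≈-sym : ∀ {x y} → x ≈ y → y ≈ x
≈-sym {sup A f} {sup B g} (l , r) =
  (λ b → proj₁ (r b) , ≈-sym (proj₂ (r b))) ,
  (λ a → proj₁ (l a) , ≈-sym (proj₂ (l a)))

≈-trans : ∀ {x y z} → x ≈ y → y ≈ z → x ≈ z
≈-trans {sup A f} {sup B g} {sup C h} (l , r) (l′ , r′) =
  (λ a → let (b , p) = l a ; (c , q) = l′ b in c , ≈-trans p q) ,
  (λ c → let (b , q) = r′ c ; (a , p) = r b in a , ≈-trans p q)

⁅_,_⁆ : V → V → V
⁅ x , y ⁆ = sup Bool λ { true → x ; false → y }

-- Kuratowski pairs.
⟨_,_⟩ : V → V → V
⟨ x , y ⟩ = ⁅ ⁅ x , x ⁆ , ⁅ x , y ⁆ ⁆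

infix 9 ⋃ᵛ_

⋃ᵛ_ : V → V
⋃ᵛ sup A f = sup (Σ[ a ∈ A ] Index (f a)) λ (a , b) → elem (f a) b

Transitive : V → Set₁
Transitive M = ∀ x → x ∈ M → x ⊆ M

Countable : V → Set₁
Countable M = Σ[ f ∈ (ℕ → V) ] (∀ x → x ∈ M → ∃[ n ] f n ≈ x)

------------------------------------------------------------------------
-- The first-order language of set theory, with de Bruijn variables
-- (0F is the innermost bound variable).

infix  8 _∈̇_ _≐_
infix  7 ¬̇_
infixr 6 _∧̇_
infixr 5 _∨̇_
infixr 4 _⇒̇_
infix  3 _⇔̇_
infixr 2 ∀̇_ ∃̇_

data Formula (n : ℕ) : Set where
  _∈̇_ _≐_         : Fin n → Fin n → Formula n
  ⊥̇               : Formula n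
  _∧̇_ _∨̇_ _⇒̇_    : Formula n → Formula n → Formula n
  ∀̇_ ∃̇_          : Formula (suc n) → Formula n

¬̇_ : ∀ {n} → Formula n → Formula n
¬̇ φ = φ ⇒̇ ⊥̇

_⇔̇_ : ∀ {n} → Formula n → Formula n → Formula n
φ ⇔̇ ψ = (φ ⇒̇ ψ) ∧̇ (ψ ⇒̇ φ)

Sentence : Set
Sentence = Formula 0

rename : ∀ {m n} → (Fin m → Fin n) → Formula m → Formula n
rename r (i ∈̇ j) = r i ∈̇ r j
rename r (i ≐ j) = r i ≐ r j
rename r ⊥̇       = ⊥̇
rename r (φ ∧̇ ψ) = rename r φ ∧̇ rename r ψ
rename r (φ ∨̇ ψ) = rename r φ ∨̇ rename r ψ
rename r (φ ⇒̇ ψ) = rename r φ ⇒̇ rename r ψ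
rename r (∀̇ φ)   = ∀̇ rename (lift 1 r) φ
rename r (∃̇ φ)   = ∃̇ rename (lift 1 r) φ

closure : ∀ {n} → Formula n → Sentence
closure {zero}  φ = φ
closure {suc n} φ = closure (∀̇ φ)

-- Satisfaction in the structure (M , ∈).
Sat : (M : V) → ∀ {n} → Formula n → (Fin n → Index M) → Set
Sat M (i ∈̇ j) ρ = elem M (ρ i) ∈ elem M (ρ j)
Sat M (i ≐ j) ρ = elem M (ρ i) ≈ elem M (ρ j)
Sat M ⊥̇       ρ = ⊥
Sat M (φ ∧̇ ψ) ρ = Sat M φ ρ × Sat M ψ ρ
Sat M (φ ∨̇ ψ) ρ = Sat M φ ρ ⊎ Sat M ψ ρ
Sat M (φ ⇒̇ ψ) ρ = Sat M φ ρ → Sat M ψ ρ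
Sat M (∀̇ φ)   ρ = ∀ a → Sat M φ (a ∷ ρ)
Sat M (∃̇ φ)   ρ = ∃[ a ] Sat M φ (a ∷ ρ)

infix 4 _⊨_

_⊨_ : V → Sentence → Set
M ⊨ φ = Sat M φ []

------------------------------------------------------------------------
-- ZFC

extensionality foundation pairing union powerset infinity choice : Sentence

extensionality =
  ∀̇ ∀̇ ((∀̇ (0F ∈̇ 2F ⇔̇ 0F ∈̇ 1F)) ⇒̇ 1F ≐ 0F)

foundation =
  ∀̇ ((∃̇ 0F ∈̇ 1F) ⇒̇ (∃̇ (0F ∈̇ 1F ∧̇ ¬̇ (∃̇ (0F ∈̇ 1F ∧̇ 0F ∈̇ 2F)))))

pairing =
  ∀̇ ∀̇ ∃̇ ∀̇ (0F ∈̇ 1F ⇔̇ 0F ≐ 3F ∨̇ 0F ≐ 2F)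

union =
  ∀̇ ∃̇ ∀̇ (0F ∈̇ 1F ⇔̇ (∃̇ (0F ∈̇ 3F ∧̇ 1F ∈̇ 0F)))

powerset =
  ∀̇ ∃̇ ∀̇ (0F ∈̇ 1F ⇔̇ (∀̇ (0F ∈̇ 1F ⇒̇ 0F ∈̇ 3F)))

-- Some w contains ∅ and is closed under x ↦ x ∪ {x}.
infinity =
  ∃̇ ((∃̇ (0F ∈̇ 1F ∧̇ ¬̇ (∃̇ 0F ∈̇ 1F)))
     ∧̇ (∀̇ (0F ∈̇ 1F ⇒̇
              (∃̇ (0F ∈̇ 2F ∧̇ (∀̇ (0F ∈̇ 1F ⇔̇ 0F ∈̇ 2F ∨̇ 0F ≐ 2F)))))))

-- Every family of nonempty, pairwise disjoint sets has a set meeting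
-- each member in exactly one point.
choice =
  ∀̇ ((∀̇ (0F ∈̇ 1F ⇒̇ (∃̇ 0F ∈̇ 1F)))
     ∧̇ (∀̇ ∀̇ (1F ∈̇ 2F ∧̇ 0F ∈̇ 2F ∧̇ (∃̇ (0F ∈̇ 2F ∧̇ 0F ∈̇ 1F)) ⇒̇ 1F ≐ 0F))
     ⇒̇ (∃̇ ∀̇ (0F ∈̇ 2F ⇒̇
                (∃̇ ∀̇ (0F ∈̇ 2F ∧̇ 0F ∈̇ 3F ⇔̇ 0F ≐ 1F)))))

-- φ(x , p⃗) with x = 0F:
-- ∀ p⃗. ∀ a. ∃ b. ∀ x. x ∈ b ⇔ x ∈ a ∧ φ(x , p⃗).
separation : ∀ {n} → Formula (1 ℕ.+ n) → Sentence
separation φ = closure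
  (∀̇ ∃̇ ∀̇ (0F ∈̇ 1F ⇔̇ 0F ∈̇ 2F ∧̇ rename (0F ∷ (3 ↑ʳ_)) φ))

-- φ(x , y , p⃗) with x = 0F, y = 1F:
-- ∀ p⃗. ∀ a. (∀ x ∈ a. ∀ y y′. φ(x , y , p⃗) ∧ φ(x , y′ , p⃗) ⇒ y = y′)
--           ⇒ ∃ b. ∀ y. y ∈ b ⇔ ∃ x ∈ a. φ(x , y , p⃗).
replacement : ∀ {n} → Formula (2 ℕ.+ n) → Sentence
replacement φ = closure
  (∀̇ ((∀̇ (0F ∈̇ 1F ⇒̇
             (∀̇ ∀̇ (rename (2F ∷ 1F ∷ (4 ↑ʳ_)) φ
                    ∧̇ rename (2F ∷ 0F ∷ (4 ↑ʳ_)) φ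
                    ⇒̇ 1F ≐ 0F))))
      ⇒̇ (∃̇ ∀̇ (0F ∈̇ 1F ⇔̇
                 (∃̇ (0F ∈̇ 3F ∧̇ rename (0F ∷ 1F ∷ (4 ↑ʳ_)) φ))))))

data ZFC : Sentence → Set where
  ext   : ZFC extensionality
  found : ZFC foundation
  pair  : ZFC pairing
  un    : ZFC union
  pow   : ZFC powerset
  inf   : ZFC infinity
  ac    : ZFC choice
  sep   : ∀ {n} (φ : Formula (1 ℕ.+ n)) → ZFC (separation φ)
  repl  : ∀ {n} (φ : Formula (2 ℕ.+ n)) → ZFC (replacement φ)

------------------------------------------------------------------------
-- Posets, as sets

record Poset : Set₁ where
  field
    carrier order : V

  infix 4 _≤_
  _≤_ : V → V → Set
  p ≤ q = ⟨ p , q ⟩ ∈ order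

  field
    ≤-on-carrier : ∀ x → x ∈ order →
                   ∃[ p ] ∃[ q ] p ∈ carrier × q ∈ carrier × x ≈ ⟨ p , q ⟩
    ≤-refl    : ∀ p → p ∈ carrier → p ≤ p
    ≤-trans   : ∀ p q r → p ≤ q → q ≤ r → p ≤ r
    ≤-antisym : ∀ p q → p ≤ q → q ≤ p → p ≈ q

  asSet : V
  asSet = ⟨ carrier , order ⟩

  Compatible : V → V → Set₁
  Compatible p q = ∃[ r ] r ∈ carrier × r ≤ p × r ≤ q

  -- D is a dense subset of the poset.
  Dense : V → Set₁
  Dense D = D ⊆ carrier × (∀ p → p ∈ carrier → ∃[ d ] d ∈ D × d ≤ p)

  record IsFilter (G : V) : Set₁ where
    field
      subset   : G ⊆ carrier
      nonempty : ∃[ p ] p ∈ G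
      upward   : ∀ p q → p ∈ G → q ∈ carrier → p ≤ q → q ∈ G
      directed : ∀ p q → p ∈ G → q ∈ G → ∃[ r ] r ∈ G × r ≤ p × r ≤ q

  -- e is the graph of an automorphism.
  record IsAutomorphism (e : V) : Set₁ where
    field
      graph      : ∀ x → x ∈ e →
                   ∃[ p ] ∃[ q ] p ∈ carrier × q ∈ carrier × x ≈ ⟨ p , q ⟩
      total      : ∀ p → p ∈ carrier → ∃[ q ] ⟨ p , q ⟩ ∈ e
      functional : ∀ p q q′ → ⟨ p , q ⟩ ∈ e → ⟨ p , q′ ⟩ ∈ e → q ≈ q′
      injective  : ∀ p p′ q → ⟨ p , q ⟩ ∈ e → ⟨ p′ , q ⟩ ∈ e → p ≈ p′
      surjective : ∀ q → q ∈ carrier → ∃[ p ] ⟨ p , q ⟩ ∈ e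
      monotone   : ∀ p p′ q q′ → ⟨ p , q ⟩ ∈ e → ⟨ p′ , q′ ⟩ ∈ e →
                   (p ≤ p′) ⇔ (q ≤ q′)

-- Weak homogeneity relativized to a transitive M containing ℙ. Being an
-- automorphism and being compatible are Δ₀ in ℙ, so only the quantifier
-- over automorphisms has to be restricted to M.
WeaklyHomogeneousIn : V → Poset → Set₁
WeaklyHomogeneousIn M ℙ =
  ∀ q r → q ∈ carrier → r ∈ carrier →
  ∃[ e ] e ∈ M × IsAutomorphism e ×
         (∃[ q′ ] ⟨ q , q′ ⟩ ∈ e × Compatible q′ r)
  where open Poset ℙ

------------------------------------------------------------------------
-- Generic extensions

-- val G τ = { val G σ ∣ ⟨ σ , p ⟩ ∈ τ for some p ∈ G }. The name σ in a
-- pair ⟨ σ , p ⟩ is an element of an element of that pair, so it is found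
-- structurally by letting it range over ⋃ᵛ of the elements of τ:
-- val⋃ G x j is val G (elem (⋃ᵛ x) j), and val∈ G x i is val G (elem x i).
mutual
  val : V → V → V
  val G (sup A f) =
    sup (Σ[ a ∈ A ] Σ[ j ∈ Index (⋃ᵛ f a) ] Σ[ i ∈ Index G ]
           f a ≈ ⟨ elem (⋃ᵛ f a) j , elem G i ⟩)
        (λ (a , j , _) → val⋃ G (f a) j)

  val⋃ : (G x : V) → Index (⋃ᵛ x) → V
  val⋃ G (sup B g) (b , c) = val∈ G (g b) c

  val∈ : (G x : V) → Index x → V
  val∈ G (sup C h) c = val G (h c)

infix 10 _[_]

_[_] : V → V → V
M [ G ] = sup (Index M) (λ i → val G (elem M i))

record Generic (M : V) (ℙ : Poset) : Set₁ where
  open Poset ℙ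
  field
    filter   : V
    isFilter : IsFilter filter
    generic  : ∀ D → D ∈ M → Dense D → ∃[ p ] p ∈ filter × p ∈ D

open Generic using (filter)

-- Gen(M,ℙ) as a set: generic filters are identified when extensionally
-- equal, regardless of the proof components.
Gen : V → Poset → Setoid (lsuc 0ℓ) 0ℓ
Gen M ℙ = record
  { Carrier       = Generic M ℙ
  ; _≈_           = λ G H → filter G ≈ filter H
  ; isEquivalence = record
    { refl = ≈-refl ; sym = ≈-sym ; trans = ≈-trans }
  }

SameExtension : (M : V) (ℙ : Poset) → Rel (Generic M ℙ) 0ℓ
SameExtension M ℙ G H = M [ filter G ] ≈ M [ filter H ]

-- The topology with basis N_p = { G ∣ p ∈ G }, p ∈ ℙ.
GenOpen : (M : V) (ℙ : Poset) → Pred (Pred (Generic M ℙ) 0ℓ) (lsuc 0ℓ)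
GenOpen M ℙ U =
  ∀ G → U G → ∃[ p ] p ∈ Poset.carrier ℙ × p ∈ filter G ×
                     (∀ H → p ∈ filter H → U H)

------------------------------------------------------------------------
-- Borel sets, standard Borel spaces and smoothness

-- The σ-algebra generated by the open sets.
data Borel {X : Set₁} (Open : Pred (Pred X 0ℓ) (lsuc 0ℓ)) :
           Pred (Pred X 0ℓ) (lsuc 0ℓ) where
  opn  : ∀ {U} → Open U → Borel Open U
  comp : ∀ {U} → Borel Open U → Borel Open (∁ U)
  cup  : ∀ (U : ℕ → Pred X 0ℓ) → (∀ n → Borel Open (U n)) →
         Borel Open (⋃ ℕ U)
  resp : ∀ {U W} → U ≐ₚ W → Borel Open U → Borel Open W

-- A complete separable metric d, presented by its upper cuts:
-- Near q x y says that d(x , y) < q.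
record PolishMetric (X : Setoid (lsuc 0ℓ) 0ℓ) : Set₁ where
  open Setoid X renaming (Carrier to |X|; _≈_ to _≈ₓ_)
  field
    Near : ℚ → |X| → |X| → Set

    nonneg   : ∀ {q x y} → Near q x y → 0ℚ < q
    finite   : ∀ x y → ∃[ q ] Near q x y
    upward   : ∀ {q r x y} → q < r → Near q x y → Near r x y
    rounded  : ∀ {q x y} → Near q x y → ∃[ r ] r < q × Near r x y

    zero-iff : ∀ x y → (x ≈ₓ y) ⇔ (∀ q → 0ℚ < q → Near q x y)
    symm     : ∀ {q x y} → Near q x y → Near q y x
    triangle : ∀ {q r x y z} → Near q x y → Near r y z → Near (q + r) x z

    complete : ∀ (s : ℕ → |X|) →
               (∀ ε → 0ℚ < ε → ∃[ N ] ∀ m n → N ℕ.≤ m → N ℕ.≤ n →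
                                        Near ε (s m) (s n)) →
               ∃[ x ] ∀ ε → 0ℚ < ε → ∃[ N ] ∀ n → N ℕ.≤ n → Near ε (s n) x

    -- The dense sequence is partial so that the empty space is allowed.
    dense     : ℕ → Maybe |X|
    separable : ∀ x ε → 0ℚ < ε →
                ∃[ n ] ∃[ y ] dense n ≡ just y × Near ε x y

  Open : Pred (Pred |X| 0ℓ) (lsuc 0ℓ)
  Open U = ∀ x → U x → ∃[ ε ] 0ℚ < ε × (∀ y → Near ε x y → U y)

-- A measurable space whose σ-algebra is that of the Borel sets of some
-- Polish topology.
record StandardBorelSpace : Set₂ where
  field
    points     : Setoid (lsuc 0ℓ) 0ℓ
    Measurable : Pred (Pred (Setoid.Carrier points) 0ℓ) (lsuc 0ℓ)
    metric     : PolishMetric points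
    borel      : ∀ U → Measurable U ⇔ Borel (PolishMetric.Open metric) U

-- E is Borel reducible to equality on a standard Borel space.
Smooth : (X : Setoid (lsuc 0ℓ) 0ℓ) →
         Pred (Pred (Setoid.Carrier X) 0ℓ) (lsuc 0ℓ) →
         Rel (Setoid.Carrier X) 0ℓ → Set₂
Smooth X Open E =
  Σ[ Y ∈ StandardBorelSpace ]
  let open StandardBorelSpace Y
      open Setoid points using () renaming (_≈_ to _≈ʸ_)
  in Σ[ f ∈ Func X points ]
       (∀ B → Measurable B → Borel Open (B ∘ Func.to f))
       × (∀ x y → E x y ⇔ (Func.to f x ≈ʸ Func.to f y))

{-# OPTIONS --safe #-}
module Submission where

-- Let ℙ be Cohen forcing with one extra atom: conditions are bounded partial
-- functions from ω to 2, coded as sets of points and ordered by reverse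
-- inclusion, except that the point 0 is compatible with no other point.
-- Automorphisms map the atom { 0 } to an atom, and no atom lies below { 1 },
-- so ℙ is not weakly homogeneous.
--
-- Below c₀ = { ⟨ 0 , 0 ⟩ } any two conditions become compatible after flipping
-- finitely many bits. Such a flip e lies in M, and replacing every condition p
-- in a name by e p, by recursion inside M, shows M[G] = M[e G]. Hence every
-- invariant Borel set contains all or none of the sufficiently generic filters
-- below c₀. A reduction to equality on a Polish space would therefore be
-- constant on a comeager set of filters, all of whose unions would lie in one
-- countable extension M[G]; but a generic filter can avoid any countable
-- family of prescribed unions.

open import Defs
open import Level using (0ℓ; Lift; lift) renaming (suc to lsuc)
open import Data.Bool.Base using (Bool; true; false; not)
open import Data.Empty using (⊥; ⊥-elim)
open import Data.Fin.Base using (Fin; zero; suc; _↑ʳ_) renaming (lift to liftᶠ)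
open import Data.Fin.Patterns using (0F; 1F; 2F; 3F; 4F; 5F; 6F; 7F)
open import Data.Nat.Base as ℕ using (ℕ; zero; suc)
open import Data.Product.Base using (Σ-syntax; ∃-syntax; _×_; _,_; proj₁; proj₂)
open import Data.Sum.Base using (_⊎_; inj₁; inj₂)
import Data.Sum.Base
open import Data.Vec.Functional using ([]; _∷_; head; tail)
open import Function.Base using (_∘_; id)
open import Function.Bundles using (_⇔_; mk⇔; Equivalence; Func)
open import Relation.Binary.Bundles using (Setoid)
open import Induction.WellFounded using (WellFounded; Acc; acc)
open import Relation.Binary.PropositionalEquality.Core using (_≡_; _≢_; refl; sym; trans; cong; subst)
open import Relation.Nullary.Negation.Core using (¬_)
open import Data.List.Base using (List) renaming ([] to []ˡ; _∷_ to infixr 5 _∷ˡ_)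
open import Data.List.Relation.Unary.All using (All) renaming ([] to []ᵃ; _∷_ to infixr 5 _∷ᵃ_)
open import Relation.Binary.Construct.Closure.Transitive using (TransClosure) renaming ([_] to [_]⁺; _∷_ to _∷⁺_; wellFounded to ⁺-wellFounded)
open import Axiom.ExcludedMiddle using (ExcludedMiddle)
open import Axiom.DoubleNegationElimination using (em⇒dne)
open import Data.Integer.Base using (+_; -[1+_])
open import Data.Maybe.Base using (Maybe; just; nothing)
open import Data.Nat.Properties using (+-comm; +-suc; suc-injective; m<n⇒m<1+n; m<n⇒0<n; n≤1+n; n<1+n; <-cmp; <-irrefl; <-≤-trans; m≤m⊔n; m≤n⊔m; m<1+n⇒m<n∨m≡n)
open import Data.Rational.Base as ℚ using (ℚ; mkℚ; 0ℚ; ½; positive)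
import Data.Rational.Properties as ℚ
open import Relation.Nullary.Decidable.Core using (yes; no)
open import Relation.Unary using (Pred; ∁; ⋃)
open import Data.Bool.Properties using (not-involutive; not-¬)
open import Relation.Binary.Definitions using (tri<; tri≈; tri>)

open Equivalence using (to; from)

-- The atom destroys homogeneity while the cone below `c₀` remains a copy of Cohen forcing, and
-- non-smoothness is witnessed on that cone alone. The obstacle is that M satisfies only finitely
-- many axioms, chosen before M. Whatever has to belong to M (ω, the poset, the flips, pulled-back
-- dense sets, translated names) is therefore cut out by an explicit instance of Separation or
-- Replacement, and formulas are read through a semantics in V that is matched with satisfaction in
-- M once and for all. The category argument, in contrast, is external: its dense classes need not
-- belong to M, and conditions decide membership in Borel sets rather than truth in M[G]. It touches
-- M in three places: a flip in M carries generic filters to generic filters, it preserves the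
-- extension, and ⋃G has a name in M. The last point turns avoidance of countably many unions into
-- M[H] ≠ M[K]: the elements of M[K] are the values of countably many names, so a generic H can be
-- chosen with ⋃H outside M[K].

elem∈ : ∀ x i → elem x i ∈ x
elem∈ x i = i , ≈-refl

∈-respˡ : ∀ z {x y} → x ≈ y → x ∈ z → y ∈ z
∈-respˡ z e (i , p) = i , ≈-trans (≈-sym e) p

∈-respʳ : ∀ x {y z} → y ≈ z → x ∈ y → x ∈ z
∈-respʳ x {sup A f} {sup B g} (l , _) (i , p) =
  proj₁ (l i) , ≈-trans p (proj₂ (l i))

≈-ext : ∀ {x y} → x ⊆ y → y ⊆ x → x ≈ y
≈-ext {sup A f} {sup B g} x⊆y y⊆x =
  (λ a → x⊆y (f a) (elem∈ (sup A f) a)) ,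
  (λ b → let (a , p) = y⊆x (g b) (elem∈ (sup B g) b) in a , ≈-sym p)

≈⇒⊆ : ∀ {x y} → x ≈ y → x ⊆ y
≈⇒⊆ e z = ∈-respʳ z e

≈⇒⊇ : ∀ {x y} → x ≈ y → y ⊆ x
≈⇒⊇ e = ≈⇒⊆ (≈-sym e)

-- Membership holds only up to `≈`, so the structural recursion on a tree has to treat all trees
-- equal to it at once.
∈-wellFounded : WellFounded _∈_
∈-wellFounded x = below x x ≈-refl
  where
  below : ∀ x y → y ≈ x → Acc _∈_ y
  below (sup A f) y e = acc λ {z} z∈y →
    let (a , p) = ∈-respʳ z e z∈y in below (f a) z p

∈-irrefl : ∀ {x} → ¬ x ∈ x
∈-irrefl {x} = go (∈-wellFounded x)
  where
  go : ∀ {x} → Acc _∈_ x → ¬ x ∈ x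
  go (acc r) x∈x = go (r x∈x) x∈x

∅ᵛ : V
∅ᵛ = sup ⊥ λ ()

∈-pair : ∀ {x y z} → z ∈ ⁅ x , y ⁆ ⇔ (z ≈ x ⊎ z ≈ y)
∈-pair = mk⇔
  (λ { (true , p) → inj₁ p ; (false , p) → inj₂ p })
  (λ { (inj₁ p) → true , p ; (inj₂ p) → false , p })

∈-⋃ : ∀ x {z} → z ∈ ⋃ᵛ x ⇔ (∃[ y ] y ∈ x × z ∈ y)
∈-⋃ (sup A f) {z} = mk⇔
  (λ { ((a , b) , p) → f a , elem∈ (sup A f) a , b , p })
  (λ { (y , (a , p) , z∈y) → let (b , q) = ∈-respʳ z p z∈y in (a , b) , q })

pair-cong : ∀ {x y x′ y′} → x ≈ x′ → y ≈ y′ → ⁅ x , y ⁆ ≈ ⁅ x′ , y′ ⁆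
pair-cong p q =
  (λ { true → true , p ; false → false , q }) ,
  (λ { true → true , p ; false → false , q })

⟨⟩-cong : ∀ {x y x′ y′} → x ≈ x′ → y ≈ y′ → ⟨ x , y ⟩ ≈ ⟨ x′ , y′ ⟩
⟨⟩-cong p q = pair-cong (pair-cong p p) (pair-cong p q)

singleton-pair : ∀ {x y z} → ⁅ x , x ⁆ ≈ ⁅ y , z ⁆ → x ≈ y × x ≈ z
singleton-pair {x} (_ , r) = part (r true) , part (r false)
  where
  part : ∀ {w} → ∃[ b ] elem ⁅ x , x ⁆ b ≈ w → x ≈ w
  part (true , p) = p
  part (false , p) = p

pair-injectiveʳ : ∀ {x y x′ y′} → x ≈ x′ → ⁅ x , y ⁆ ≈ ⁅ x′ , y′ ⁆ → y ≈ y′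
pair-injectiveʳ e (l , r) with r false
... | false , p = p
... | true , p with l false
...   | false , q = q
...   | true , q = ≈-trans (≈-trans q (≈-sym e)) p

-- Once the first components agree, cancelling a common element works twice: {x} in the outer pair,
-- then x in the inner one.
⟨⟩-injective : ∀ {x y x′ y′} → ⟨ x , y ⟩ ≈ ⟨ x′ , y′ ⟩ → x ≈ x′ × y ≈ y′
⟨⟩-injective {x} {y} {x′} {y′} e@(l , _) =
  x≈x′ , pair-injectiveʳ x≈x′ (pair-injectiveʳ (pair-cong x≈x′ x≈x′) e)
  where
  first : ∃[ b ] ⁅ x , x ⁆ ≈ elem ⟨ x′ , y′ ⟩ b → x ≈ x′
  first (true , p) = proj₁ (singleton-pair p)
  first (false , p) = proj₁ (singleton-pair p)

  x≈x′ : x ≈ x′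
  x≈x′ = first (l true)

⟨⟩∈-resp : ∀ r {x y x′ y′} → x ≈ x′ → y ≈ y′ → ⟨ x , y ⟩ ∈ r → ⟨ x′ , y′ ⟩ ∈ r
⟨⟩∈-resp r p q = ∈-respˡ r (⟨⟩-cong p q)

-- An extension of the language of set theory by ordered pairs and bounded
-- quantifiers. Its semantics is stated for arbitrary sets rather than for
-- the indices of M.

infix  8 _∈̂_ _≈̂_ _≈̂⟨_,_⟩ ⟨_,_⟩∈̂_
infixr 6 _∧̂_
infixr 5 _∨̂_
infixr 4 _⇒̂_

data Fm (n : ℕ) : Set where
  _∈̂_ _≈̂_ : Fin n → Fin n → Fm n
  _≈̂⟨_,_⟩ : Fin n → Fin n → Fin n → Fm n
  ⟨_,_⟩∈̂_ : Fin n → Fin n → Fin n → Fm n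
  ⊥̂ : Fm n
  _∧̂_ _∨̂_ _⇒̂_ : Fm n → Fm n → Fm n
  ∀̂ ∃̂ : Fm (suc n) → Fm n
  ∀̂∈ ∃̂∈ : Fin n → Fm (suc n) → Fm n

isPair : ∀ {n} → Fin n → Fin n → Fin n → Formula n
isPair k i j = ∀̇ (0F ∈̇ suc k ⇔̇ (0F ≐ suc i ∨̇ 0F ≐ suc j))

isOrderedPair : ∀ {n} → Fin n → Fin n → Fin n → Formula n
isOrderedPair k i j =
  ∃̇ ∃̇ (isPair 1F (suc (suc i)) (suc (suc i)) ∧̇
        isPair 0F (suc (suc i)) (suc (suc j)) ∧̇
        isPair (suc (suc k)) 1F 0F)

⌜_⌝ : ∀ {n} → Fm n → Formula n
⌜ i ∈̂ j ⌝ = i ∈̇ j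
⌜ i ≈̂ j ⌝ = i ≐ j
⌜ k ≈̂⟨ i , j ⟩ ⌝ = isOrderedPair k i j
⌜ ⟨ i , j ⟩∈̂ k ⌝ = ∃̇ (0F ∈̇ suc k ∧̇ isOrderedPair 0F (suc i) (suc j))
⌜ ⊥̂ ⌝ = ⊥̇
⌜ φ ∧̂ ψ ⌝ = ⌜ φ ⌝ ∧̇ ⌜ ψ ⌝
⌜ φ ∨̂ ψ ⌝ = ⌜ φ ⌝ ∨̇ ⌜ ψ ⌝
⌜ φ ⇒̂ ψ ⌝ = ⌜ φ ⌝ ⇒̇ ⌜ ψ ⌝
⌜ ∀̂ φ ⌝ = ∀̇ ⌜ φ ⌝
⌜ ∃̂ φ ⌝ = ∃̇ ⌜ φ ⌝
⌜ ∀̂∈ i φ ⌝ = ∀̇ (0F ∈̇ suc i ⇒̇ ⌜ φ ⌝)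
⌜ ∃̂∈ i φ ⌝ = ∃̇ (0F ∈̇ suc i ∧̇ ⌜ φ ⌝)

¬̂_ : ∀ {n} → Fm n → Fm n
¬̂ φ = φ ⇒̂ ⊥̂

Sem : V → ∀ {n} → Fm n → (Fin n → V) → Set₁
Sem M (i ∈̂ j) ρ = Lift _ (ρ i ∈ ρ j)
Sem M (i ≈̂ j) ρ = Lift _ (ρ i ≈ ρ j)
Sem M (k ≈̂⟨ i , j ⟩) ρ = Lift _ (ρ k ≈ ⟨ ρ i , ρ j ⟩)
Sem M (⟨ i , j ⟩∈̂ k) ρ = Lift _ (⟨ ρ i , ρ j ⟩ ∈ ρ k)
Sem M ⊥̂ ρ = Lift _ ⊥
Sem M (φ ∧̂ ψ) ρ = Sem M φ ρ × Sem M ψ ρ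
Sem M (φ ∨̂ ψ) ρ = Sem M φ ρ ⊎ Sem M ψ ρ
Sem M (φ ⇒̂ ψ) ρ = Sem M φ ρ → Sem M ψ ρ
Sem M (∀̂ φ) ρ = ∀ x → x ∈ M → Sem M φ (x ∷ ρ)
Sem M (∃̂ φ) ρ = ∃[ x ] x ∈ M × Sem M φ (x ∷ ρ)
Sem M (∀̂∈ i φ) ρ = ∀ x → x ∈ ρ i → Sem M φ (x ∷ ρ)
Sem M (∃̂∈ i φ) ρ = ∃[ x ] x ∈ ρ i × Sem M φ (x ∷ ρ)

Sat-rename : ∀ M {m n} (φ : Formula m) (r : Fin m → Fin n) ρ ρ′ →
             (∀ i → ρ (r i) ≡ ρ′ i) → Sat M (rename r φ) ρ ⇔ Sat M φ ρ′
Sat-rename M (i ∈̇ j) r ρ ρ′ h rewrite h i | h j = mk⇔ id id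
Sat-rename M (i ≐ j) r ρ ρ′ h rewrite h i | h j = mk⇔ id id
Sat-rename M ⊥̇ r ρ ρ′ h = mk⇔ id id
Sat-rename M (φ ∧̇ ψ) r ρ ρ′ h =
  let p = Sat-rename M φ r ρ ρ′ h ; q = Sat-rename M ψ r ρ ρ′ h in
  mk⇔ (λ (a , b) → to p a , to q b) (λ (a , b) → from p a , from q b)
Sat-rename M (φ ∨̇ ψ) r ρ ρ′ h =
  let p = Sat-rename M φ r ρ ρ′ h ; q = Sat-rename M ψ r ρ ρ′ h in
  mk⇔ (λ { (inj₁ a) → inj₁ (to p a) ; (inj₂ b) → inj₂ (to q b) })
      (λ { (inj₁ a) → inj₁ (from p a) ; (inj₂ b) → inj₂ (from q b) })
Sat-rename M (φ ⇒̇ ψ) r ρ ρ′ h =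
  let p = Sat-rename M φ r ρ ρ′ h ; q = Sat-rename M ψ r ρ ρ′ h in
  mk⇔ (λ f a → to q (f (from p a))) (λ f a → from q (f (to p a)))
Sat-rename M (∀̇ φ) r ρ ρ′ h =
  let p = λ a → Sat-rename M φ (liftᶠ 1 r) (a ∷ ρ) (a ∷ ρ′) λ { zero → refl ; (suc i) → h i } in
  mk⇔ (λ f a → to (p a) (f a)) (λ f a → from (p a) (f a))
Sat-rename M (∃̇ φ) r ρ ρ′ h =
  let p = λ a → Sat-rename M φ (liftᶠ 1 r) (a ∷ ρ) (a ∷ ρ′) λ { zero → refl ; (suc i) → h i } in
  mk⇔ (λ (a , s) → a , to (p a) s) (λ (a , s) → a , from (p a) s)

-- Instantiating the quantifiers one by one rebuilds the environment with `_∷_`; without function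
-- extensionality it is only pointwise equal to ρ.
Sat-closure : ∀ M {n} (φ : Formula n) → M ⊨ closure φ → ∀ (ρ : Fin n → Index M) →
              Σ[ ρ′ ∈ (Fin n → Index M) ] (∀ i → ρ′ i ≡ ρ i) × Sat M φ ρ′
Sat-closure M {zero} φ s ρ = [] , (λ ()) , s
Sat-closure M {suc n} φ s ρ with Sat-closure M (∀̇ φ) s (tail ρ)
... | ρ′ , h , f = head ρ ∷ ρ′ , (λ { zero → refl ; (suc i) → h i }) , f (head ρ)

-- Comprehension in M

module PairClosed (M : V) (M-transitive : Transitive M) (M-pairing : M ⊨ pairing) where

  private
    ⟦_⟧ : Index M → V
    ⟦_⟧ = elem M

  ⟦⟧∈M : ∀ a → ⟦ a ⟧ ∈ M
  ⟦⟧∈M = elem∈ M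

  M-member : ∀ {x y} → x ∈ y → y ∈ M → x ∈ M
  M-member {x} {y} x∈y y∈M = M-transitive y y∈M x x∈y

  private
    -- Absoluteness by transitivity: all elements of ρ k have indices in M, so the quantifier over M
    -- sees every one of them.
    Sat-isPair : ∀ {n} (k i j : Fin n) ρ →
                 Sat M (isPair k i j) ρ ⇔ ⟦ ρ k ⟧ ≈ ⁅ ⟦ ρ i ⟧ , ⟦ ρ j ⟧ ⁆
    Sat-isPair k i j ρ = mk⇔ forth back
      where
      forth : Sat M (isPair k i j) ρ → ⟦ ρ k ⟧ ≈ ⁅ ⟦ ρ i ⟧ , ⟦ ρ j ⟧ ⁆
      forth s = ≈-ext
        (λ z z∈k → let (a , p) = M-member z∈k (⟦⟧∈M (ρ k)) in
          ∈-respˡ ⁅ ⟦ ρ i ⟧ , ⟦ ρ j ⟧ ⁆ (≈-sym p)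
            (from ∈-pair (proj₁ (s a) (∈-respˡ ⟦ ρ k ⟧ p z∈k))))
        (λ { z (true , p) → ∈-respˡ ⟦ ρ k ⟧ (≈-sym p)
                              (proj₂ (s (ρ i)) (inj₁ ≈-refl))
           ; z (false , p) → ∈-respˡ ⟦ ρ k ⟧ (≈-sym p)
                              (proj₂ (s (ρ j)) (inj₂ ≈-refl)) })
      back : ⟦ ρ k ⟧ ≈ ⁅ ⟦ ρ i ⟧ , ⟦ ρ j ⟧ ⁆ → Sat M (isPair k i j) ρ
      back e a =
        (λ h → to ∈-pair (≈⇒⊆ e ⟦ a ⟧ h)) ,
        (λ h → ≈⇒⊇ e ⟦ a ⟧ (from ∈-pair h))

    pairIndex : ∀ a b → ∃[ c ] ⟦ c ⟧ ≈ ⁅ ⟦ a ⟧ , ⟦ b ⟧ ⁆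
    pairIndex a b = let (c , s) = M-pairing a b in
      c , to (Sat-isPair 2F 1F 0F (b ∷ a ∷ c ∷ [])) s

  abstract
    pair∈M : ∀ {x y} → x ∈ M → y ∈ M → ⁅ x , y ⁆ ∈ M
    pair∈M (a , p) (b , q) = let (c , e) = pairIndex a b in
      c , ≈-trans (pair-cong p q) (≈-sym e)

  ⟨⟩∈M : ∀ {x y} → x ∈ M → y ∈ M → ⟨ x , y ⟩ ∈ M
  ⟨⟩∈M p q = pair∈M (pair∈M p p) (pair∈M p q)

  unpair∈M : ∀ {x y} → ⁅ x , y ⁆ ∈ M → x ∈ M × y ∈ M
  unpair∈M {x} {y} p =
    M-member (elem∈ ⁅ x , y ⁆ true) p , M-member (elem∈ ⁅ x , y ⁆ false) p

  components∈M : ∀ {x y} → ⟨ x , y ⟩ ∈ M → x ∈ M × y ∈ M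
  components∈M p = unpair∈M (proj₂ (unpair∈M p))

  components∈M′ : ∀ {x y r} → ⟨ x , y ⟩ ∈ r → r ∈ M → x ∈ M × y ∈ M
  components∈M′ p r∈M = components∈M (M-member p r∈M)

  private
    Sat-isOrderedPair : ∀ {n} (k i j : Fin n) ρ →
      Sat M (isOrderedPair k i j) ρ ⇔ ⟦ ρ k ⟧ ≈ ⟨ ⟦ ρ i ⟧ , ⟦ ρ j ⟧ ⟩
    Sat-isOrderedPair {n} k i j ρ = mk⇔
      (λ (a , b , p , q , r) →
        let p′ = to (Sat-isPair {suc (suc n)} 1F (suc (suc i)) (suc (suc i)) (b ∷ a ∷ ρ)) p
            q′ = to (Sat-isPair {suc (suc n)} 0F (suc (suc i)) (suc (suc j)) (b ∷ a ∷ ρ)) q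
            r′ = to (Sat-isPair (suc (suc k)) 1F 0F (b ∷ a ∷ ρ)) r
        in ≈-trans r′ (pair-cong p′ q′))
      (λ e →
        let (a , p) = pairIndex (ρ i) (ρ i) ; (b , q) = pairIndex (ρ i) (ρ j) in
        a , b ,
        from (Sat-isPair {suc (suc n)} 1F (suc (suc i)) (suc (suc i)) (b ∷ a ∷ ρ)) p ,
        from (Sat-isPair {suc (suc n)} 0F (suc (suc i)) (suc (suc j)) (b ∷ a ∷ ρ)) q ,
        from (Sat-isPair (suc (suc k)) 1F 0F (b ∷ a ∷ ρ))
          (≈-trans e (≈-sym (pair-cong p q))))

  -- Letting σ be only extensionally equal to ρ makes Sem invariant under ≈.
  abstract
    Sat⇔Sem : ∀ {n} (φ : Fm n) (ρ : Fin n → Index M) (σ : Fin n → V) →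
              (∀ i → σ i ≈ ⟦ ρ i ⟧) → Sat M ⌜ φ ⌝ ρ ⇔ Sem M φ σ
    Sat⇔Sem (i ∈̂ j) ρ σ h = mk⇔
      (λ s → lift (∈-respˡ (σ j) (≈-sym (h i)) (≈⇒⊇ (h j) ⟦ ρ i ⟧ s)))
      (λ (lift s) → ∈-respˡ ⟦ ρ j ⟧ (h i) (≈⇒⊆ (h j) (σ i) s))
    Sat⇔Sem (i ≈̂ j) ρ σ h = mk⇔
      (λ s → lift (≈-trans (h i) (≈-trans s (≈-sym (h j)))))
      (λ (lift s) → ≈-trans (≈-sym (h i)) (≈-trans s (h j)))
    Sat⇔Sem (k ≈̂⟨ i , j ⟩) ρ σ h = mk⇔
      (λ s → lift (≈-trans (h k) (≈-trans (to (Sat-isOrderedPair k i j ρ) s) (≈-sym cong′))))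
      (λ (lift s) → from (Sat-isOrderedPair k i j ρ)
               (≈-trans (≈-sym (h k)) (≈-trans s cong′)))
      where
      cong′ : ⟨ σ i , σ j ⟩ ≈ ⟨ ⟦ ρ i ⟧ , ⟦ ρ j ⟧ ⟩
      cong′ = ⟨⟩-cong (h i) (h j)
    Sat⇔Sem {n} (⟨ i , j ⟩∈̂ k) ρ σ h = mk⇔
      (λ (a , p , s) → lift
        (∈-respˡ (σ k)
          (≈-trans (to (Sat-isOrderedPair {suc n} 0F (suc i) (suc j) (a ∷ ρ)) s) (≈-sym cong′))
          (≈⇒⊇ (h k) ⟦ a ⟧ p)))
      (λ (lift s) →
        let s′ = ∈-respˡ ⟦ ρ k ⟧ cong′ (≈⇒⊆ (h k) ⟨ σ i , σ j ⟩ s)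
            (a , e) = M-member s′ (⟦⟧∈M (ρ k))
        in a , ∈-respˡ ⟦ ρ k ⟧ e s′ ,
           from (Sat-isOrderedPair {suc n} 0F (suc i) (suc j) (a ∷ ρ)) (≈-sym e))
      where
      cong′ : ⟨ σ i , σ j ⟩ ≈ ⟨ ⟦ ρ i ⟧ , ⟦ ρ j ⟧ ⟩
      cong′ = ⟨⟩-cong (h i) (h j)
    Sat⇔Sem ⊥̂ ρ σ h = mk⇔ lift Lift.lower
    Sat⇔Sem (φ ∧̂ ψ) ρ σ h =
      let p = Sat⇔Sem φ ρ σ h ; q = Sat⇔Sem ψ ρ σ h in
      mk⇔ (λ (a , b) → to p a , to q b) (λ (a , b) → from p a , from q b)
    Sat⇔Sem (φ ∨̂ ψ) ρ σ h =
      let p = Sat⇔Sem φ ρ σ h ; q = Sat⇔Sem ψ ρ σ h in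
      mk⇔ (λ { (inj₁ a) → inj₁ (to p a) ; (inj₂ b) → inj₂ (to q b) })
          (λ { (inj₁ a) → inj₁ (from p a) ; (inj₂ b) → inj₂ (from q b) })
    Sat⇔Sem (φ ⇒̂ ψ) ρ σ h =
      let p = Sat⇔Sem φ ρ σ h ; q = Sat⇔Sem ψ ρ σ h in
      mk⇔ (λ f a → to q (f (from p a))) (λ f a → from q (f (to p a)))
    Sat⇔Sem (∀̂ φ) ρ σ h = mk⇔
      (λ f x (a , p) → to (Sat⇔Sem φ (a ∷ ρ) (x ∷ σ) λ { zero → p ; (suc i) → h i }) (f a))
      (λ f a → from (Sat⇔Sem φ (a ∷ ρ) (⟦ a ⟧ ∷ σ) λ { zero → ≈-refl ; (suc i) → h i })
                 (f ⟦ a ⟧ (⟦⟧∈M a)))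
    Sat⇔Sem (∃̂ φ) ρ σ h = mk⇔
      (λ (a , s) → ⟦ a ⟧ , ⟦⟧∈M a ,
        to (Sat⇔Sem φ (a ∷ ρ) (⟦ a ⟧ ∷ σ) λ { zero → ≈-refl ; (suc i) → h i }) s)
      (λ (x , (a , p) , s) →
        a , from (Sat⇔Sem φ (a ∷ ρ) (x ∷ σ) λ { zero → p ; (suc i) → h i }) s)
    Sat⇔Sem (∀̂∈ j φ) ρ σ h = mk⇔
      (λ f x x∈j →
        let x∈j′ = ≈⇒⊆ (h j) x x∈j
            (a , p) = M-member x∈j′ (⟦⟧∈M (ρ j)) in
        to (Sat⇔Sem φ (a ∷ ρ) (x ∷ σ) λ { zero → p ; (suc i) → h i })
          (f a (∈-respˡ ⟦ ρ j ⟧ p x∈j′)))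
      (λ f a a∈j →
        from (Sat⇔Sem φ (a ∷ ρ) (⟦ a ⟧ ∷ σ) λ { zero → ≈-refl ; (suc i) → h i })
          (f ⟦ a ⟧ (≈⇒⊇ (h j) ⟦ a ⟧ a∈j)))
    Sat⇔Sem (∃̂∈ j φ) ρ σ h = mk⇔
      (λ (a , a∈j , s) → ⟦ a ⟧ , ≈⇒⊇ (h j) ⟦ a ⟧ a∈j ,
        to (Sat⇔Sem φ (a ∷ ρ) (⟦ a ⟧ ∷ σ) λ { zero → ≈-refl ; (suc i) → h i }) s)
      (λ (x , x∈j , s) →
        let x∈j′ = ≈⇒⊆ (h j) x x∈j
            (a , p) = M-member x∈j′ (⟦⟧∈M (ρ j)) in
        a , ∈-respˡ ⟦ ρ j ⟧ p x∈j′ ,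
        from (Sat⇔Sem φ (a ∷ ρ) (x ∷ σ) λ { zero → p ; (suc i) → h i }) s)

  abstract
    Sem-resp : ∀ {n} (φ : Fm n) (σ σ′ : Fin n → V) → (∀ i → σ i ∈ M) →
               (∀ i → σ′ i ≈ σ i) → Sem M φ σ → Sem M φ σ′
    Sem-resp φ σ σ′ σ∈M h s =
      to (Sat⇔Sem φ (proj₁ ∘ σ∈M) σ′ λ i → ≈-trans (h i) (proj₂ (σ∈M i)))
        (from (Sat⇔Sem φ (proj₁ ∘ σ∈M) σ (proj₂ ∘ σ∈M)) s)

  private
    ≈-reindex : ∀ {n} {σ : Fin n → V} (σ∈M : ∀ i → σ i ∈ M) {ρ : Fin n → Index M} →
                (∀ i → ρ i ≡ proj₁ (σ∈M i)) → ∀ i → σ i ≈ ⟦ ρ i ⟧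
    ≈-reindex {σ = σ} σ∈M h i = subst (λ a → σ i ≈ ⟦ a ⟧) (sym (h i)) (proj₂ (σ∈M i))

  abstract
    comprehend : ∀ {n} (φ : Fm (suc n)) → M ⊨ separation ⌜ φ ⌝ →
                 ∀ (σ : Fin n → V) → (∀ i → σ i ∈ M) → ∀ a → a ∈ M →
                 ∃[ b ] b ∈ M × (∀ x → x ∈ b ⇔ (x ∈ a × Sem M φ (x ∷ σ)))
    comprehend φ ax σ σ∈M a (ia , a≈)
      with Sat-closure M _ ax (proj₁ ∘ σ∈M)
    ... | ρ , h , s = ⟦ ib ⟧ , ⟦⟧∈M ib , λ x → mk⇔ (forth x) (back x)
      where
      ib : Index M
      ib = proj₁ (s ia)

      sem : ∀ x ix → x ≈ ⟦ ix ⟧ →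
        Sat M (rename (0F ∷ (3 ↑ʳ_)) ⌜ φ ⌝) (ix ∷ ib ∷ ia ∷ ρ) ⇔ Sem M φ (x ∷ σ)
      sem x ix x≈ =
        let p = Sat-rename M ⌜ φ ⌝ (0F ∷ (3 ↑ʳ_)) (ix ∷ ib ∷ ia ∷ ρ) (ix ∷ ρ)
                  λ { zero → refl ; (suc i) → refl }
            q = Sat⇔Sem φ (ix ∷ ρ) (x ∷ σ) λ { zero → x≈ ; (suc i) → ≈-reindex {σ = σ} σ∈M h i }
        in mk⇔ (to q ∘ to p) (from p ∘ from q)

      forth : ∀ x → x ∈ ⟦ ib ⟧ → x ∈ a × Sem M φ (x ∷ σ)
      forth x x∈b =
        let (ix , x≈) = M-member x∈b (⟦⟧∈M ib)
            (x∈a , t) = proj₁ (proj₂ (s ia) ix) (∈-respˡ ⟦ ib ⟧ x≈ x∈b)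
        in ∈-respˡ a (≈-sym x≈) (≈⇒⊇ a≈ ⟦ ix ⟧ x∈a) , to (sem x ix x≈) t

      back : ∀ x → x ∈ a × Sem M φ (x ∷ σ) → x ∈ ⟦ ib ⟧
      back x (x∈a , t) =
        let (ix , x≈) = M-member x∈a (ia , a≈) in
        ∈-respˡ ⟦ ib ⟧ (≈-sym x≈)
          (proj₂ (proj₂ (s ia) ix)
            (∈-respˡ ⟦ ia ⟧ x≈ (≈⇒⊆ a≈ x x∈a) , from (sem x ix x≈) t))

  abstract
    replace : ∀ {n} (φ : Fm (suc (suc n))) → M ⊨ replacement ⌜ φ ⌝ →
              ∀ (σ : Fin n → V) → (∀ i → σ i ∈ M) → ∀ a → a ∈ M →
              (∀ x y y′ → x ∈ a → y ∈ M → y′ ∈ M →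
                Sem M φ (x ∷ y ∷ σ) → Sem M φ (x ∷ y′ ∷ σ) → y ≈ y′) →
              ∃[ b ] b ∈ M ×
                (∀ y → y ∈ b ⇔ (y ∈ M × ∃[ x ] x ∈ a × Sem M φ (x ∷ y ∷ σ)))
    replace φ ax σ σ∈M a (ia , a≈) functional
      with Sat-closure M _ ax (proj₁ ∘ σ∈M)
    ... | ρ , h , s = ⟦ ib ⟧ , ⟦⟧∈M ib , λ y → mk⇔ (forth y) (back y)
      where
      sem : ∀ {k} (r : Fin _ → Fin k) (ρ′ : Fin k → Index M) x ix y iy → x ≈ ⟦ ix ⟧ → y ≈ ⟦ iy ⟧ →
        (∀ i → ρ′ (r i) ≡ (ix ∷ iy ∷ ρ) i) →
        Sat M (rename r ⌜ φ ⌝) ρ′ ⇔ Sem M φ (x ∷ y ∷ σ)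
      sem r ρ′ x ix y iy x≈ y≈ e =
        let p = Sat-rename M ⌜ φ ⌝ r ρ′ (ix ∷ iy ∷ ρ) e
            q = Sat⇔Sem φ (ix ∷ iy ∷ ρ) (x ∷ y ∷ σ)
                  λ { zero → x≈ ; (suc zero) → y≈ ; (suc (suc i)) → ≈-reindex {σ = σ} σ∈M h i }
        in mk⇔ (to q ∘ to p) (from p ∘ from q)

      inImage : Index M → Index M → Set
      inImage iy b = ∃[ ix ] ⟦ ix ⟧ ∈ ⟦ ia ⟧ ×
        Sat M (rename (0F ∷ 1F ∷ (4 ↑ʳ_)) ⌜ φ ⌝) (ix ∷ iy ∷ b ∷ ia ∷ ρ)

      image : ∃[ b ] ∀ iy → (⟦ iy ⟧ ∈ ⟦ b ⟧ → inImage iy b) × (inImage iy b → ⟦ iy ⟧ ∈ ⟦ b ⟧)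
      image = s ia λ ix ix∈a iy iy′ (t , t′) →
        let x = ⟦ ix ⟧ ; y = ⟦ iy ⟧ ; y′ = ⟦ iy′ ⟧ in
        functional x y y′ (≈⇒⊇ a≈ x ix∈a) (⟦⟧∈M iy) (⟦⟧∈M iy′)
          (to (sem (2F ∷ 1F ∷ (4 ↑ʳ_)) (iy′ ∷ iy ∷ ix ∷ ia ∷ ρ) x ix y iy ≈-refl ≈-refl
                λ { zero → refl ; (suc zero) → refl ; (suc (suc i)) → refl }) t)
          (to (sem (2F ∷ 0F ∷ (4 ↑ʳ_)) (iy′ ∷ iy ∷ ix ∷ ia ∷ ρ) x ix y′ iy′ ≈-refl ≈-refl
                λ { zero → refl ; (suc zero) → refl ; (suc (suc i)) → refl }) t′)

      ib : Index M
      ib = proj₁ image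

      sem′ : ∀ x ix y iy → x ≈ ⟦ ix ⟧ → y ≈ ⟦ iy ⟧ →
        Sat M (rename (0F ∷ 1F ∷ (4 ↑ʳ_)) ⌜ φ ⌝) (ix ∷ iy ∷ ib ∷ ia ∷ ρ) ⇔ Sem M φ (x ∷ y ∷ σ)
      sem′ x ix y iy x≈ y≈ = sem (0F ∷ 1F ∷ (4 ↑ʳ_)) (ix ∷ iy ∷ ib ∷ ia ∷ ρ) x ix y iy x≈ y≈
        λ { zero → refl ; (suc zero) → refl ; (suc (suc i)) → refl }

      forth : ∀ y → y ∈ ⟦ ib ⟧ → y ∈ M × ∃[ x ] x ∈ a × Sem M φ (x ∷ y ∷ σ)
      forth y y∈b =
        let y∈M@(iy , y≈) = M-member y∈b (⟦⟧∈M ib)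
            (ix , x∈a , t) = proj₁ (proj₂ image iy) (∈-respˡ ⟦ ib ⟧ y≈ y∈b)
        in y∈M , ⟦ ix ⟧ , ≈⇒⊇ a≈ ⟦ ix ⟧ x∈a ,
           to (sem′ ⟦ ix ⟧ ix y iy ≈-refl y≈) t

      back : ∀ y → y ∈ M × ∃[ x ] x ∈ a × Sem M φ (x ∷ y ∷ σ) → y ∈ ⟦ ib ⟧
      back y ((iy , y≈) , x , x∈a , t) =
        let (ix , x≈) = M-member x∈a (ia , a≈) in
        ∈-respˡ ⟦ ib ⟧ (≈-sym y≈)
          (proj₂ (proj₂ image iy)
            (ix , ∈-respˡ ⟦ ia ⟧ x≈ (≈⇒⊆ a≈ x x∈a) ,
             from (sem′ x ix y iy x≈ y≈) t))

-- The instances of the axiom schemes. The variables, innermost first, are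
--   conditionᶠ  p ω               disagreeᶠ  x p q
--   extendsᶠ    q p ⟨p,q⟩ K       flipᶠ      q p ⟨p,q⟩ K D
--   preimageᶠ   p d e             collectᶠ   y g x e k
--   valueᶠ      q u ⟨u,q⟩ A x U e k
--   nameᶠ       p u ⟨u,p⟩ A g
-- and graph φ is { ⟨ x , y ⟩ ∈ A × A ∣ φ (y , x , ⟨ x , y ⟩ , A , …) }.

graph : ∀ {n} → Fm (4 ℕ.+ n) → Fm (2 ℕ.+ n)
graph φ = ∃̂∈ 1F (∃̂∈ 2F (2F ≈̂⟨ 1F , 0F ⟩ ∧̂ φ))

emptyᶠ successorᶠ : ∀ {n} → Fin n → Fm n
emptyᶠ x = ∀̂∈ x ⊥̂
successorᶠ x = ∃̂∈ x (∀̂∈ (suc x) (0F ∈̂ 1F ∨̂ 0F ≈̂ 1F) ∧̂ ∀̂∈ 0F (0F ∈̂ suc (suc x)))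

-- Zero or a successor, and hereditarily so for the elements. As V is well-founded, descending
-- through predecessors ends at ∅, so exactly the numerals satisfy this.
naturalᶠ : Fm 1
naturalᶠ = (emptyᶠ 0F ∨̂ successorᶠ 0F) ∧̂ ∀̂∈ 0F (emptyᶠ 0F ∨̂ successorᶠ 0F)

-- The numeral m stands for the m-th bit being 1 and ⟨ m , m ⟩ for its being 0.
-- As 0 conflicts with every other point, the condition { 0 } is an atom.
partnerᶠ conflictᶠ : ∀ {n} → Fin n → Fin n → Fm n
partnerᶠ x y = y ≈̂⟨ x , x ⟩ ∨̂ x ≈̂⟨ y , y ⟩
conflictᶠ x y = y ≈̂⟨ x , x ⟩ ∨̂ (emptyᶠ x ∧̂ ¬̂ emptyᶠ y)

-- Finiteness is expressed by a numeral that bounds all bits mentioned in p.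
conditionᶠ : Fm 2
conditionᶠ =
  ∃̂∈ 1F (∀̂∈ 1F (∃̂∈ 1F (1F ≈̂ 0F ∨̂ 1F ≈̂⟨ 0F , 0F ⟩))) ∧̂
  ∀̂∈ 0F (∀̂∈ 1F (¬̂ conflictᶠ 1F 0F))

extendsᶠ : Fm 4
extendsᶠ = ∀̂∈ 0F (0F ∈̂ 2F)

disagreeᶠ : Fm 3
disagreeᶠ = (0F ∈̂ 1F ∧̂ ∃̂∈ 2F (partnerᶠ 1F 0F)) ∨̂ (0F ∈̂ 2F ∧̂ ∃̂∈ 1F (partnerᶠ 1F 0F))

flippedᶠ : ∀ {n} → (D p x : Fin n) → Fm n
flippedᶠ D p x = (x ∈̂ D ∧̂ ∃̂∈ p (partnerᶠ (suc x) 0F)) ∨̂ (¬̂ (x ∈̂ D) ∧̂ x ∈̂ p)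

flipᶠ : Fm 5
flipᶠ = ∀̂ ((0F ∈̂ 1F ⇒̂ flippedᶠ 5F 2F 0F) ∧̂ (flippedᶠ 5F 2F 0F ⇒̂ 0F ∈̂ 1F))

preimageᶠ : Fm 3
preimageᶠ = ∃̂∈ 1F (⟨ 1F , 0F ⟩∈̂ 3F)

-- Two recursions in one. With k empty, T replaces each condition of a name by its images under e;
-- with e empty, T x is the check name of x, in which every condition of k is attached to every
-- element.
stepᶠ : ∀ {n} → (e k x y q : Fin n) → Fm n
stepᶠ e k x y q =
  ∃̂ (⟨ suc y , 0F ⟩∈̂ suc x ∧̂ ⟨ 0F , suc q ⟩∈̂ suc e) ∨̂ (y ∈̂ x ∧̂ q ∈̂ k)

inDomainᶠ : ∀ {n} → (g x : Fin n) → Fm n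
inDomainᶠ g x = ∃̂ (⟨ suc x , 0F ⟩∈̂ suc g)

-- A set of argument-value pairs obeying the recursion equation. The second clause also closes its
-- domain under the arguments that a step reaches; single-valuedness then follows by induction, in
-- `attempt-unique`.
attemptᶠ : ∀ {n} → (e k g : Fin n) → Fm n
attemptᶠ e k g = ∀̂ (∀̂ (⟨ 1F , 0F ⟩∈̂ (2 ↑ʳ g) ⇒̂
  (∀̂∈ 0F (∃̂ (∃̂ (∃̂
     (3F ≈̂⟨ 1F , 0F ⟩ ∧̂ stepᶠ (6 ↑ʳ e) (6 ↑ʳ k) 5F 2F 0F ∧̂ ⟨ 2F , 1F ⟩∈̂ (6 ↑ʳ g)))))
  ∧̂ ∀̂ (∀̂ (stepᶠ (4 ↑ʳ e) (4 ↑ʳ k) 3F 1F 0F ⇒̂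
     ∃̂ (⟨ 2F , 0F ⟩∈̂ (5 ↑ʳ g) ∧̂ ⟨ 0F , 1F ⟩∈̂ 3F))))))

leastAttemptᶠ : ∀ {n} → (e k x g : Fin n) → Fm n
leastAttemptᶠ e k x g = attemptᶠ e k g ∧̂ inDomainᶠ g x ∧̂
  ∀̂ (attemptᶠ (suc e) (suc k) 0F ⇒̂ inDomainᶠ 0F (suc x) ⇒̂ ∀̂∈ (suc g) (0F ∈̂ 1F))

collectᶠ : Fm 5
collectᶠ = leastAttemptᶠ 3F 4F 0F 1F ∧̂ ∃̂ (stepᶠ 4F 5F 3F 1F 0F)

valueᶠ : Fm 8
valueᶠ = ∃̂ (stepᶠ 7F (suc 7F) 5F 0F 1F ∧̂ ⟨ 0F , 2F ⟩∈̂ 6F)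

-- The usual name of the union of the generic filter: all pairs of the check name of x with p, for x
-- ∈ p.
nameᶠ : Fm 5
nameᶠ = ∃̂∈ 0F (⟨ 0F , 2F ⟩∈̂ 5F)

Γ : List Sentence
Γ = pairing ∷ˡ union ∷ˡ powerset ∷ˡ infinity
  ∷ˡ separation ⌜ naturalᶠ ⌝ ∷ˡ separation ⌜ conditionᶠ ⌝ ∷ˡ separation ⌜ graph extendsᶠ ⌝
  ∷ˡ separation ⌜ disagreeᶠ ⌝ ∷ˡ separation ⌜ flippedᶠ {3} 1F 2F 0F ⌝
  ∷ˡ separation ⌜ graph flipᶠ ⌝ ∷ˡ separation ⌜ preimageᶠ ⌝
  ∷ˡ separation ⌜ graph valueᶠ ⌝ ∷ˡ separation ⌜ graph nameᶠ ⌝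
  ∷ˡ replacement ⌜ collectᶠ ⌝ ∷ˡ []ˡ

Γ-ZFC : All ZFC Γ
Γ-ZFC = pair ∷ᵃ un ∷ᵃ pow ∷ᵃ inf
  ∷ᵃ sep ⌜ naturalᶠ ⌝
  ∷ᵃ sep ⌜ conditionᶠ ⌝
  ∷ᵃ sep ⌜ graph extendsᶠ ⌝
  ∷ᵃ sep ⌜ disagreeᶠ ⌝
  ∷ᵃ sep ⌜ flippedᶠ {3} 1F 2F 0F ⌝
  ∷ᵃ sep ⌜ graph flipᶠ ⌝
  ∷ᵃ sep ⌜ preimageᶠ ⌝
  ∷ᵃ sep ⌜ graph valueᶠ ⌝
  ∷ᵃ sep ⌜ graph nameᶠ ⌝
  ∷ᵃ repl ⌜ collectᶠ ⌝ ∷ᵃ []ᵃ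

record Model (M : V) : Set₁ where
  field
    M-transitive : Transitive M
    M-countable : Countable M
    M-pairing : M ⊨ pairing
    M-union : M ⊨ union
    M-powerset : M ⊨ powerset
    M-infinity : M ⊨ infinity
    natural-sep : M ⊨ separation ⌜ naturalᶠ ⌝
    condition-sep : M ⊨ separation ⌜ conditionᶠ ⌝
    extends-sep : M ⊨ separation ⌜ graph extendsᶠ ⌝
    disagree-sep : M ⊨ separation ⌜ disagreeᶠ ⌝
    flipped-sep : M ⊨ separation ⌜ flippedᶠ {3} 1F 2F 0F ⌝
    flip-sep : M ⊨ separation ⌜ graph flipᶠ ⌝
    preimage-sep : M ⊨ separation ⌜ preimageᶠ ⌝
    value-sep : M ⊨ separation ⌜ graph valueᶠ ⌝
    name-sep : M ⊨ separation ⌜ graph nameᶠ ⌝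
    collect-repl : M ⊨ replacement ⌜ collectᶠ ⌝

model : ∀ {M} → Transitive M → Countable M → All (M ⊨_) Γ → Model M
model trans count (a₁ ∷ᵃ a₂ ∷ᵃ a₃ ∷ᵃ a₄ ∷ᵃ a₅ ∷ᵃ a₆ ∷ᵃ a₇ ∷ᵃ a₈ ∷ᵃ a₉ ∷ᵃ a₁₀ ∷ᵃ a₁₁ ∷ᵃ a₁₂ ∷ᵃ a₁₃ ∷ᵃ a₁₄ ∷ᵃ []ᵃ) = record
  { M-transitive = trans ; M-countable = count
  ; M-pairing = a₁ ; M-union = a₂ ; M-powerset = a₃ ; M-infinity = a₄
  ; natural-sep = a₅ ; condition-sep = a₆ ; extends-sep = a₇ ; disagree-sep = a₈
  ; flipped-sep = a₉ ; flip-sep = a₁₀ ; preimage-sep = a₁₁ ; value-sep = a₁₂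
  ; name-sep = a₁₃ ; collect-repl = a₁₄ }

-- Unions, power sets and definable relations in M

infixr 7 _∪_

_∪_ : V → V → V
x ∪ y = ⋃ᵛ ⁅ x , y ⁆

∈-∪ : ∀ {x y z} → z ∈ x ∪ y ⇔ (z ∈ x ⊎ z ∈ y)
∈-∪ {x} {y} {z} = mk⇔
  (λ { ((true , i) , p) → inj₁ (i , p) ; ((false , i) , p) → inj₂ (i , p) })
  (λ { (inj₁ (i , p)) → (true , i) , p ; (inj₂ (i , p)) → (false , i) , p })

∪ˡ : ∀ {x} y {z} → z ∈ x → z ∈ x ∪ y
∪ˡ {x} y {z} p = from (∈-∪ {x} {y} {z}) (inj₁ p)

∪ʳ : ∀ x {y z} → z ∈ y → z ∈ x ∪ y
∪ʳ x {y} {z} p = from (∈-∪ {x} {y} {z}) (inj₂ p)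

field∈ : ∀ r {x y} → ⟨ x , y ⟩ ∈ r → x ∈ ⋃ᵛ ⋃ᵛ r × y ∈ ⋃ᵛ ⋃ᵛ r
field∈ r {x} {y} p =
  from (∈-⋃ (⋃ᵛ r)) (⁅ x , y ⁆ , q , elem∈ ⁅ x , y ⁆ true) ,
  from (∈-⋃ (⋃ᵛ r)) (⁅ x , y ⁆ , q , elem∈ ⁅ x , y ⁆ false)
  where
  q : ⁅ x , y ⁆ ∈ ⋃ᵛ r
  q = from (∈-⋃ r) (⟨ x , y ⟩ , p , elem∈ ⟨ x , y ⟩ false)

module ClosureProperties {M : V} (𝓜 : Model M) where
  open Model 𝓜
  open PairClosed M M-transitive M-pairing public

  infixr 5 _∷ᴹ_

  []ᴹ : ∀ i → [] i ∈ M
  []ᴹ ()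

  _∷ᴹ_ : ∀ {n x} {σ : Fin n → V} → x ∈ M → (∀ i → σ i ∈ M) → ∀ i → (x ∷ σ) i ∈ M
  (x∈M ∷ᴹ σ∈M) zero = x∈M
  (x∈M ∷ᴹ σ∈M) (suc i) = σ∈M i

  abstract
    ⋃∈M : ∀ {x} → x ∈ M → ⋃ᵛ x ∈ M
    ⋃∈M {x} (a , x≈) = let (b , s) = M-union a in b , ≈-ext
      (λ z z∈⋃ →
        let (y , y∈x , z∈y) = to (∈-⋃ x) z∈⋃
            y∈a = ≈⇒⊆ x≈ y y∈x
            (d , y≈) = M-member y∈a (⟦⟧∈M a)
            (c , z≈) = M-member z∈y (d , y≈)
        in ∈-respˡ (elem M b) (≈-sym z≈)
             (proj₂ (s c) (d , ∈-respˡ (elem M a) y≈ y∈a ,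
                ∈-respˡ (elem M d) z≈ (≈⇒⊆ y≈ z z∈y))))
      (λ z z∈b →
        let (c , z≈) = M-member z∈b (⟦⟧∈M b)
            (d , d∈a , c∈d) = proj₁ (s c) (∈-respˡ (elem M b) z≈ z∈b)
        in from (∈-⋃ x) (elem M d , ≈⇒⊇ x≈ (elem M d) d∈a , ∈-respˡ (elem M d) (≈-sym z≈) c∈d))

  ∪∈M : ∀ {x y} → x ∈ M → y ∈ M → x ∪ y ∈ M
  ∪∈M p q = ⋃∈M (pair∈M p q)

  abstract
    power : ∀ {x} → x ∈ M → ∃[ P ] P ∈ M × (∀ z → z ∈ P ⇔ (z ∈ M × z ⊆ x))
    power {x} (a , x≈) = let (b , s) = M-powerset a in elem M b , ⟦⟧∈M b , λ z → mk⇔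
      (λ z∈b →
        let (c , z≈) = M-member z∈b (⟦⟧∈M b) in
        (c , z≈) , λ w w∈z →
          let (d , w≈) = M-member w∈z (c , z≈) in
          ≈⇒⊇ x≈ w (∈-respˡ (elem M a) (≈-sym w≈)
            (proj₁ (s c) (∈-respˡ (elem M b) z≈ z∈b) d
              (∈-respˡ (elem M c) w≈ (≈⇒⊆ z≈ w w∈z)))))
      (λ ((c , z≈) , z⊆x) → ∈-respˡ (elem M b) (≈-sym z≈)
        (proj₂ (s c) λ d d∈c → ≈⇒⊆ x≈ (elem M d) (z⊆x (elem M d) (≈⇒⊇ z≈ (elem M d) d∈c))))

  ⁅⁆⊆ : ∀ a {x y} → x ∈ a → y ∈ a → ⁅ x , y ⁆ ⊆ a
  ⁅⁆⊆ a x∈a y∈a z (true , p) = ∈-respˡ a (≈-sym p) x∈a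
  ⁅⁆⊆ a x∈a y∈a z (false , p) = ∈-respˡ a (≈-sym p) y∈a

  abstract
    -- Kuratowski pairs over a lie in the double power set of a, which serves as the bound when
    -- relations on a are separated.
    square : ∀ {a} → a ∈ M → ∃[ s ] s ∈ M × (∀ {x y} → x ∈ a → y ∈ a → ⟨ x , y ⟩ ∈ s)
    square {a} a∈M =
      let (P , P∈M , P⇔) = power a∈M
          (PP , PP∈M , PP⇔) = power P∈M
          ∈M : ∀ {x} → x ∈ a → x ∈ M
          ∈M x∈a = M-member x∈a a∈M
          ∈P : ∀ {x y} → x ∈ a → y ∈ a → ⁅ x , y ⁆ ∈ P
          ∈P {x} {y} x∈a y∈a =
            from (P⇔ ⁅ x , y ⁆) (pair∈M (∈M x∈a) (∈M y∈a) , ⁅⁆⊆ a x∈a y∈a)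
      in PP , PP∈M , λ {x} {y} x∈a y∈a →
        from (PP⇔ ⟨ x , y ⟩) (⟨⟩∈M (∈M x∈a) (∈M y∈a) , ⁅⁆⊆ P (∈P x∈a x∈a) (∈P x∈a y∈a))

    relate : ∀ {n} (φ : Fm (4 ℕ.+ n)) → M ⊨ separation ⌜ graph φ ⌝ →
             ∀ {σ : Fin n → V} → (∀ i → σ i ∈ M) → ∀ {a} → a ∈ M →
             ∃[ r ] r ∈ M ×
               (∀ z → z ∈ r → ∃[ x ] ∃[ y ] x ∈ a × y ∈ a × z ≈ ⟨ x , y ⟩) ×
               (∀ x y → ⟨ x , y ⟩ ∈ r ⇔
                 (x ∈ a × y ∈ a × Sem M φ (y ∷ x ∷ ⟨ x , y ⟩ ∷ a ∷ σ)))
    relate {n} φ ax {σ} σ∈M {a} a∈M =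
      let (s , s∈M , ⟨⟩∈s) = square a∈M
          (r , r∈M , r⇔) = comprehend (graph φ) ax (a ∷ σ) (a∈M ∷ᴹ σ∈M) s s∈M
      in r , r∈M ,
         (λ z z∈r → let (_ , x , x∈a , y , y∈a , lift z≈ , _) = to (r⇔ z) z∈r in
            x , y , x∈a , y∈a , z≈) ,
         λ x y → mk⇔
           (λ p → let (_ , x′ , x′∈a , y′ , y′∈a , lift z≈ , t) = to (r⇔ ⟨ x , y ⟩) p in
              transport x y x′ y′ x′∈a y′∈a z≈ t)
           (λ (x∈a , y∈a , t) → from (r⇔ ⟨ x , y ⟩)
              (⟨⟩∈s x∈a y∈a , x , x∈a , y , y∈a , lift (≈-refl) , t))
      where
      -- The formula speaks of components recovered from the pair, which agree with x and y only up
      -- to `≈`.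
      transport : ∀ x y x′ y′ → x′ ∈ a → y′ ∈ a → ⟨ x , y ⟩ ≈ ⟨ x′ , y′ ⟩ →
                  Sem M φ (y′ ∷ x′ ∷ ⟨ x , y ⟩ ∷ a ∷ σ) →
                  x ∈ a × y ∈ a × Sem M φ (y ∷ x ∷ ⟨ x , y ⟩ ∷ a ∷ σ)
      transport x y x′ y′ x′∈a y′∈a z≈ t =
        let (x≈ , y≈) = ⟨⟩-injective z≈
            x∈a = ∈-respˡ a (≈-sym x≈) x′∈a
            y∈a = ∈-respˡ a (≈-sym y≈) y′∈a
            ∈M : ∀ {w} → w ∈ a → w ∈ M
            ∈M w∈a = M-member w∈a a∈M
            σ≈ : ∀ i → (y ∷ x ∷ ⟨ x , y ⟩ ∷ a ∷ σ) i ≈ (y′ ∷ x′ ∷ ⟨ x , y ⟩ ∷ a ∷ σ) i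
            σ≈ = λ { zero → y≈ ; (suc zero) → x≈ ; (suc (suc i)) → ≈-refl }
        in x∈a , y∈a ,
           Sem-resp φ (y′ ∷ x′ ∷ ⟨ x , y ⟩ ∷ a ∷ σ) (y ∷ x ∷ ⟨ x , y ⟩ ∷ a ∷ σ)
             (∈M y′∈a ∷ᴹ ∈M x′∈a ∷ᴹ ⟨⟩∈M (∈M x∈a) (∈M y∈a) ∷ᴹ a∈M ∷ᴹ σ∈M) σ≈ t

  ∅∈M : ∃[ e ] e ∈ M × (∀ z → ¬ z ∈ e)
  ∅∈M = let (w , (e , e∈w , e-empty) , _) = M-infinity in
    elem M e , ⟦⟧∈M e , λ z z∈e →
      let (c , z≈) = M-member z∈e (⟦⟧∈M e) in e-empty (c , ∈-respˡ (elem M e) z≈ z∈e)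

-- Recursion inside M: T x = { ⟨ T y , q ⟩ ∣ step x y q }. A least set of
-- pairs witnessing the value at x is unique, so Replacement can collect the
-- witnesses at the arguments below x, without transitive closures in M.

module Recursion {M : V} (𝓜 : Model M) {e k : V} (e∈M : e ∈ M) (k∈M : k ∈ M) where
  open Model 𝓜
  open ClosureProperties 𝓜

  Step : V → V → V → Set₁
  Step x y q = Sem M (stepᶠ 3F 4F 0F 1F 2F) (x ∷ y ∷ q ∷ e ∷ k ∷ [])

  Attempt : V → Set₁
  Attempt g = Sem M (attemptᶠ 1F 2F 0F) (g ∷ e ∷ k ∷ [])

  InDomain : V → V → Set₁
  InDomain g x = Sem M (inDomainᶠ 0F 1F) (g ∷ x ∷ [])

  Step-below : ∀ {x y q} → Step x y q → TransClosure _∈_ y x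
  Step-below {x} {y} (inj₁ (p , _ , lift yp , _)) =
    elem∈ ⁅ y , p ⁆ true ∷⁺ elem∈ ⟨ y , p ⟩ false ∷⁺ [ yp ]⁺
  Step-below (inj₂ (lift y∈x , _)) = [ y∈x ]⁺

  private
    LeastAttempt : V → V → Set₁
    LeastAttempt x g = Sem M (leastAttemptᶠ 2F 3F 0F 1F) (x ∷ g ∷ e ∷ k ∷ [])

    Step-resp : ∀ {x x′ y q} → x ≈ x′ → Step x y q → Step x′ y q
    Step-resp {y = y} x≈ (inj₁ (p , p∈M , lift yp , pq)) =
      inj₁ (p , p∈M , lift (≈⇒⊆ x≈ ⟨ y , p ⟩ yp) , pq)
    Step-resp {y = y} x≈ (inj₂ (lift y∈x , q∈k)) = inj₂ (lift (≈⇒⊆ x≈ y y∈x) , q∈k)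

    -- A set in M containing every argument the recursion consults at x: elements of x for one
    -- clause of `stepᶠ`, first components of pairs in x for the other. Replacement needs such a
    -- bound.
    below : V → V
    below x = x ∪ ⋃ᵛ ⋃ᵛ x

    Step∈below : ∀ x {y q} → Step x y q → y ∈ below x
    Step∈below x (inj₁ (p , _ , lift yp , _)) = ∪ʳ x (proj₁ (field∈ x yp))
    Step∈below x (inj₂ (lift y∈x , _)) = ∪ˡ (⋃ᵛ ⋃ᵛ x) y∈x

    range : V
    range = k ∪ ⋃ᵛ ⋃ᵛ e

    Step∈range : ∀ x {y q} → Step x y q → q ∈ range
    Step∈range _ (inj₁ (_ , _ , _ , lift pq)) = ∪ʳ k (proj₂ (field∈ e pq))
    Step∈range _ (inj₂ (_ , lift q∈k)) = ∪ˡ (⋃ᵛ ⋃ᵛ e) q∈k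

    below∈M : ∀ {x} → x ∈ M → below x ∈ M
    below∈M x∈M = ∪∈M x∈M (⋃∈M (⋃∈M x∈M))

    range∈M : range ∈ M
    range∈M = ∪∈M k∈M (⋃∈M (⋃∈M e∈M))

    ⟨⟩≈∈ : ∀ v {z u u′ q} → z ≈ ⟨ u , q ⟩ → u ≈ u′ → ⟨ u′ , q ⟩ ∈ v → z ∈ v
    ⟨⟩≈∈ v {z} {u} {u′} {q} z≈ u≈ p =
      ∈-respˡ v (≈-sym (≈-trans z≈ (⟨⟩-cong u≈ ≈-refl))) p

  -- Induction on x. One inclusion at x uses equality of the values at earlier arguments, hence both
  -- inclusions there, so the induction quantifies over both attempts.
  attempt-unique : ∀ {x g g′ v v′} → g ∈ M → g′ ∈ M → Attempt g → Attempt g′ →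
                   ⟨ x , v ⟩ ∈ g → ⟨ x , v′ ⟩ ∈ g′ → v ≈ v′
  attempt-unique {x} {g} {g′} g∈M g′∈M att att′ p p′ =
    ≈-ext (include x (⁺-wellFounded _∈_ ∈-wellFounded x) g∈M g′∈M att att′ p p′)
          (include x (⁺-wellFounded _∈_ ∈-wellFounded x) g′∈M g∈M att′ att p′ p)
    where
    include : ∀ x → Acc (TransClosure _∈_) x → ∀ {g g′ v v′} → g ∈ M → g′ ∈ M →
              Attempt g → Attempt g′ → ⟨ x , v ⟩ ∈ g → ⟨ x , v′ ⟩ ∈ g′ → v ⊆ v′
    include x (acc rs) {g} {g′} {v} {v′} g∈M g′∈M att att′ p p′ z z∈v =
      let (x∈M , v∈M) = components∈M′ p g∈M
          (_ , v′∈M) = components∈M′ p′ g′∈M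
          (y , y∈M , u , u∈M , q , q∈M , lift z≈ , step , lift yu) =
            proj₁ (att x x∈M v v∈M (lift p)) z z∈v
          (u′ , u′∈M , lift yu′ , lift u′q) =
            proj₂ (att′ x x∈M v′ v′∈M (lift p′)) y y∈M q q∈M step
          r = rs (Step-below step)
      in ⟨⟩≈∈ v′ z≈ (≈-ext (include y r g∈M g′∈M att att′ yu yu′)
                           (include y r g′∈M g∈M att′ att yu′ yu)) u′q

  private
    least-unique : ∀ {x g g′} → g ∈ M → g′ ∈ M → LeastAttempt x g → LeastAttempt x g′ → g ≈ g′
    least-unique g∈M g′∈M (att , dom , least) (att′ , dom′ , least′) = ≈-ext
      (λ w w∈g → Lift.lower (least _ g′∈M att′ dom′ w w∈g))
      (λ w w∈g′ → Lift.lower (least′ _ g∈M att dom w w∈g′))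

  module _ {x} (x∈M : x ∈ M)
    (IH : ∀ {y q} → y ∈ M → Step x y q → ∃[ g ] g ∈ M × LeastAttempt y g) where

    private
      collected : ∃[ b ] b ∈ M × (∀ g → g ∈ b ⇔ (g ∈ M × ∃[ y ] y ∈ below x ×
                    (LeastAttempt y g × ∃[ q ] q ∈ M × Step x y q)))
      collected = replace collectᶠ collect-repl (x ∷ e ∷ k ∷ [])
        (x∈M ∷ᴹ e∈M ∷ᴹ k∈M ∷ᴹ []ᴹ) (below x) (below∈M x∈M)
        λ y g g′ y∈a g∈M g′∈M (l , _) (l′ , _) → least-unique g∈M g′∈M l l′

    -- The union U of the least attempts at the arguments below x is extended by the value v that U
    -- dictates at x. The result is least: an attempt defined at x is defined at all those
    -- arguments, so it includes each collected least attempt, and its value at x is v by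
    -- uniqueness.
    extend-attempt : ∃[ g ] g ∈ M × LeastAttempt x g
    extend-attempt with collected
    ... | b , b∈M , b⇔
      -- The pairs ⟨u,q⟩ of the new value have u in the field of ⋃b, two unions further down, and q
      -- in `range`.
      with relate valueᶠ value-sep {x ∷ ⋃ᵛ b ∷ e ∷ k ∷ []}
             (x∈M ∷ᴹ ⋃∈M b∈M ∷ᴹ e∈M ∷ᴹ k∈M ∷ᴹ []ᴹ)
             {⋃ᵛ ⋃ᵛ ⋃ᵛ b ∪ range} (∪∈M (⋃∈M (⋃∈M (⋃∈M b∈M))) range∈M)
    ... | v , v∈M , v-pairs , v⇔ = g , g∈M , attempt , inDomain , least
      where
      U g : V
      U = ⋃ᵛ b
      g = U ∪ ⁅ ⟨ x , v ⟩ , ⟨ x , v ⟩ ⁆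

      g∈M : g ∈ M
      g∈M = ∪∈M (⋃∈M b∈M) (pair∈M (⟨⟩∈M x∈M v∈M) (⟨⟩∈M x∈M v∈M))

      U⊆g : ∀ {w} → w ∈ U → w ∈ g
      U⊆g = ∪ˡ ⁅ ⟨ x , v ⟩ , ⟨ x , v ⟩ ⁆

      xv∈g : ⟨ x , v ⟩ ∈ g
      xv∈g = ∪ʳ U (elem∈ ⁅ ⟨ x , v ⟩ , ⟨ x , v ⟩ ⁆ true)

      g-cases : ∀ {w} → w ∈ g → w ∈ U ⊎ w ≈ ⟨ x , v ⟩
      g-cases {w} w∈g with to (∈-∪ {U} {⁅ ⟨ x , v ⟩ , ⟨ x , v ⟩ ⁆} {w}) w∈g
      ... | inj₁ w∈U = inj₁ w∈U
      ... | inj₂ (true , p) = inj₂ p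
      ... | inj₂ (false , p) = inj₂ p

      value-at : ∀ {y q} → y ∈ M → Step x y q → ∃[ u ] u ∈ M × ⟨ y , u ⟩ ∈ U × ⟨ u , q ⟩ ∈ v
      value-at {y} {q} y∈M step =
        let (g′ , g′∈M , l@(_ , (u , u∈M , lift yu) , _)) = IH y∈M step
            q∈M = M-member (Step∈range x step) range∈M
            g′∈b = from (b⇔ g′) (g′∈M , y , Step∈below x step , l , q , q∈M , step)
            yu∈U = from (∈-⋃ b) (g′ , g′∈b , yu)
        in u , u∈M , yu∈U ,
           from (v⇔ u q)
             (∪ˡ range (proj₂ (field∈ U yu∈U)) , ∪ʳ (⋃ᵛ ⋃ᵛ U) (Step∈range x step) ,
              y , y∈M , step , lift yu∈U)

      attempt : Attempt g
      attempt x′ x′∈M v′ v′∈M (lift p) with g-cases p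
      ... | inj₁ p∈U =
        let (g′ , g′∈b , p′) = to (∈-⋃ b) p∈U
            (_ , _ , _ , (att , _) , _) = to (b⇔ g′) g′∈b
            (part₁ , part₂) = att x′ x′∈M v′ v′∈M (lift p′)
            g′⊆g : ∀ {w} → w ∈ g′ → w ∈ g
            g′⊆g w∈g′ = U⊆g (from (∈-⋃ b) (g′ , g′∈b , w∈g′))
        in (λ z z∈v′ →
              let (y , y∈M , u , u∈M , q , q∈M , z≈ , step , lift yu) = part₁ z z∈v′ in
              y , y∈M , u , u∈M , q , q∈M , z≈ , step , lift (g′⊆g yu)) ,
           (λ y y∈M q q∈M step →
              let (u , u∈M , lift yu , uq) = part₂ y y∈M q q∈M step in
              u , u∈M , lift (g′⊆g yu) , uq)
      ... | inj₂ p≈ =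
        let (x≈ , v≈) = ⟨⟩-injective p≈ in
        (λ z z∈v′ →
          let z∈v = ≈⇒⊆ v≈ z z∈v′
              (u , q , _ , _ , z≈) = v-pairs z z∈v
              uq = ∈-respˡ v z≈ z∈v
              (u∈M , q∈M) = components∈M′ uq v∈M
              (_ , _ , y , y∈M , step , lift yu) = to (v⇔ u q) uq
          in y , y∈M , u , u∈M , q , q∈M , lift z≈ , Step-resp (≈-sym x≈) step , lift (U⊆g yu)) ,
        (λ y y∈M q q∈M step →
          let (u , u∈M , yu , uq) = value-at y∈M (Step-resp x≈ step) in
          u , u∈M , lift (U⊆g yu) , lift (≈⇒⊇ v≈ ⟨ u , q ⟩ uq))

      inDomain : InDomain g x
      inDomain = v , v∈M , lift xv∈g

      least : ∀ g′ → g′ ∈ M → Attempt g′ → InDomain g′ x → ∀ w → w ∈ g → Lift _ (w ∈ g′)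
      least g′ g′∈M att (v′ , v′∈M , lift p) w w∈g with g-cases w∈g
      ... | inj₁ w∈U =
        let (h , h∈b , w∈h) = to (∈-⋃ b) w∈U
            (h∈M , y , y∈a , (_ , _ , h-least) , q , q∈M , step) = to (b⇔ h) h∈b
            y∈M = M-member y∈a (below∈M x∈M)
            (u , u∈M , yu , _) = proj₂ (att x x∈M v′ v′∈M (lift p)) y y∈M q q∈M step
        in h-least g′ g′∈M att (u , u∈M , yu) w w∈h
      ... | inj₂ w≈ =
        let v≈ = attempt-unique g∈M g′∈M attempt att xv∈g p in
        lift (∈-respˡ g′ (≈-sym (≈-trans w≈ (⟨⟩-cong ≈-refl v≈))) p)

  abstract
    recursion : ∀ {x} → x ∈ M → ∃[ g ] g ∈ M × Attempt g × InDomain g x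
    recursion {x} x∈M =
      let (g , g∈M , att , dom , _) = go x (⁺-wellFounded _∈_ ∈-wellFounded x) x∈M in
      g , g∈M , att , dom
      where
      go : ∀ x → Acc (TransClosure _∈_) x → x ∈ M → ∃[ g ] g ∈ M × LeastAttempt x g
      go x (acc rs) x∈M = extend-attempt x∈M λ {y} y∈M step → go y (rs (Step-below step)) y∈M

-- Names

module _ (G : V) where

  private
    val∈-elem : ∀ x i → val∈ G x i ≡ val G (elem x i)
    val∈-elem (sup C h) c = refl

    val⋃-elem : ∀ x j → val⋃ G x j ≡ val G (elem (⋃ᵛ x) j)
    val⋃-elem (sup B g) (b , c) = val∈-elem (g b) c

  val-elim : ∀ {z} τ → z ∈ val G τ → ∃[ σ ] ∃[ p ] ⟨ σ , p ⟩ ∈ τ × p ∈ G × z ≈ val G σ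
  val-elim {z} (sup A f) ((a , j , i , p) , z≈) =
    elem (⋃ᵛ f a) j , elem G i , (a , ≈-sym p) , elem∈ G i ,
    subst (z ≈_) (val⋃-elem (f a) j) z≈

  private
    -- The name stored in τ is only `≈` to σ, so congruence at σ is needed. Taking it as a
    -- hypothesis lets `val-cong` use this lemma within its own induction.
    val-intro′ : ∀ {σ p} τ → (∀ σ′ → σ ≈ σ′ → val G σ ≈ val G σ′) →
                 ⟨ σ , p ⟩ ∈ τ → p ∈ G → val G σ ∈ val G τ
    val-intro′ {σ} {p} (sup A f) val-σ (a , e) (i , p≈) =
      (a , j , i , ≈-trans (≈-sym e) (⟨⟩-cong σ≈ p≈)) ,
      subst (val G σ ≈_) (sym (val⋃-elem (f a) j)) (val-σ _ σ≈)
      where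
      σ∈ : σ ∈ ⋃ᵛ f a
      σ∈ = from (∈-⋃ (f a))
        (⁅ σ , p ⁆ , ≈⇒⊆ e ⁅ σ , p ⁆ (elem∈ ⟨ σ , p ⟩ false) , elem∈ ⁅ σ , p ⁆ true)
      j = proj₁ σ∈
      σ≈ : σ ≈ elem (⋃ᵛ f a) j
      σ≈ = proj₂ σ∈

  val-cong : ∀ {x y} → x ≈ y → val G x ≈ val G y
  val-cong {x} {y} = go x (⁺-wellFounded _∈_ ∈-wellFounded x) y
    where
    below : ∀ {σ p x} → ⟨ σ , p ⟩ ∈ x → TransClosure _∈_ σ x
    below {σ} {p} σp∈x = elem∈ ⁅ σ , p ⁆ true ∷⁺ elem∈ ⟨ σ , p ⟩ false ∷⁺ [ σp∈x ]⁺

    go : ∀ x → Acc (TransClosure _∈_) x → ∀ y → x ≈ y → val G x ≈ val G y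
    go x (acc rs) y x≈y = ≈-ext (include x y (λ σp∈x → σp∈x) (≈⇒⊆ x≈y))
                                (include y x (≈⇒⊇ x≈y _) (≈⇒⊇ x≈y))
      where
      -- Stated for any u inside x, so that both inclusions recurse into names below x, where
      -- accessibility is at hand.
      include : ∀ u v → (∀ {w} → w ∈ u → w ∈ x) → u ⊆ v → val G u ⊆ val G v
      include u v u⊆x u⊆v z z∈u =
        let (σ , p , σp∈u , p∈G , z≈) = val-elim u z∈u in
        ∈-respˡ (val G v) (≈-sym z≈)
          (val-intro′ v (go σ (rs (below (u⊆x σp∈u)))) (u⊆v ⟨ σ , p ⟩ σp∈u) p∈G)

  val-intro : ∀ {σ p} τ → ⟨ σ , p ⟩ ∈ τ → p ∈ G → val G σ ∈ val G τ
  val-intro τ = val-intro′ τ λ σ′ → val-cong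

∈-extension : ∀ M G {z} → z ∈ M [ G ] ⇔ (∃[ τ ] τ ∈ M × z ≈ val G τ)
∈-extension M G = mk⇔
  (λ (i , z≈) → elem M i , elem∈ M i , z≈)
  (λ (τ , (i , τ≈) , z≈) → i , ≈-trans z≈ (val-cong G τ≈))

module Names {M : V} (𝓜 : Model M) where
  open Model 𝓜
  open ClosureProperties 𝓜

  module _ {e} (e∈M : e ∈ M) {G H : V}
    (forth : ∀ {p} → p ∈ G → ∃[ q ] q ∈ H × ⟨ p , q ⟩ ∈ e)
    (back : ∀ {p q} → q ∈ H → ⟨ p , q ⟩ ∈ e → p ∈ G) where

    private
      ∅ = proj₁ ∅∈M
      ∅-empty = proj₂ (proj₂ ∅∈M)
      open Recursion 𝓜 e∈M (proj₁ (proj₂ ∅∈M))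

      module _ {g} (g∈M : g ∈ M) (att : Attempt g) where

        -- The translated name v carries the conditions of x moved along e. By `forth` and `back`, a
        -- condition is in G exactly when a copy of it is in H, so corresponding pairs are active
        -- together.
        val-translate : ∀ x → Acc (TransClosure _∈_) x → ∀ {v} → ⟨ x , v ⟩ ∈ g → val G x ≈ val H v
        val-translate x (acc rs) {v} p = ≈-ext include include′
          where
          x∈M : x ∈ M
          x∈M = proj₁ (components∈M′ p g∈M)
          v∈M : v ∈ M
          v∈M = proj₂ (components∈M′ p g∈M)

          include : val G x ⊆ val H v
          include z z∈ =
            let (y , r , yr∈x , r∈G , z≈) = val-elim G x z∈
                (q , q∈H , rq∈e) = forth r∈G
                (y∈M , r∈M) = components∈M′ yr∈x x∈M
                q∈M = proj₂ (components∈M′ rq∈e e∈M)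
                step : Step x y q
                step = inj₁ (r , r∈M , lift yr∈x , lift rq∈e)
                (u , _ , lift yu , lift uq) = proj₂ (att x x∈M v v∈M (lift p)) y y∈M q q∈M step
                y≈u = val-translate y (rs (Step-below {x} step)) yu
            in ∈-respˡ (val H v) (≈-sym (≈-trans z≈ y≈u)) (val-intro H v uq q∈H)

          include′ : val H v ⊆ val G x
          include′ z z∈ with val-elim H v z∈
          ... | u , q , uq∈v , q∈H , z≈
            with proj₁ (att x x∈M v v∈M (lift p)) ⟨ u , q ⟩ uq∈v
          -- The check-name clause of the step is void, since its set of conditions is empty here.
          ... | _ , _ , _ , _ , _ , _ , _ , inj₂ (_ , lift q∈∅) , _ = ⊥-elim (∅-empty _ q∈∅)
          ... | y , _ , u′ , _ , q′ , _ , lift uq≈ , step@(inj₁ (r , _ , lift yr∈x , lift rq∈e)) , lift yu =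
            let (u≈ , q≈) = ⟨⟩-injective uq≈
                y≈u = val-translate y (rs (Step-below {x} step)) yu
            in ∈-respˡ (val G x)
                 (≈-trans y≈u (≈-trans (val-cong H (≈-sym u≈)) (≈-sym z≈)))
                 (val-intro G x yr∈x (back (∈-respˡ H q≈ q∈H) rq∈e))

    extension-⊆ : M [ G ] ⊆ M [ H ]
    extension-⊆ z z∈ =
      let (τ , τ∈M , z≈) = to (∈-extension M G) z∈
          (g , g∈M , att , v , v∈M , lift p) = recursion τ∈M
      in from (∈-extension M H)
           (v , v∈M , ≈-trans z≈ (val-translate g∈M att τ (⁺-wellFounded _∈_ ∈-wellFounded τ) p))

  module Check {k} (k∈M : k ∈ M) where
    private
      ∅ = proj₁ ∅∈M
      ∅-empty = proj₂ (proj₂ ∅∈M)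
    open Recursion 𝓜 (proj₁ (proj₂ ∅∈M)) k∈M

    val-check : ∀ {g} → g ∈ M → Attempt g → ∀ {G} → ∃[ q ] q ∈ k × q ∈ G →
                ∀ {x v} → ⟨ x , v ⟩ ∈ g → val G v ≈ x
    val-check {g} g∈M att {G} (q , q∈k , q∈G) {x} = go x (⁺-wellFounded _∈_ ∈-wellFounded x)
      where
      go : ∀ x → Acc (TransClosure _∈_) x → ∀ {v} → ⟨ x , v ⟩ ∈ g → val G v ≈ x
      go x (acc rs) {v} p = ≈-ext include include′
        where
        x∈M : x ∈ M
        x∈M = proj₁ (components∈M′ p g∈M)
        v∈M : v ∈ M
        v∈M = proj₂ (components∈M′ p g∈M)

        include : val G v ⊆ x
        include z z∈ with val-elim G v z∈
        ... | u , r , ur∈v , r∈G , z≈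
          with proj₁ (att x x∈M v v∈M (lift p)) ⟨ u , r ⟩ ur∈v
        ... | _ , _ , _ , _ , _ , _ , _ , inj₁ (_ , _ , _ , lift r∈∅) , _ = ⊥-elim (∅-empty _ r∈∅)
        ... | y , _ , u′ , _ , r′ , _ , lift ur≈ , step@(inj₂ (lift y∈x , _)) , lift yu =
          let (u≈ , _) = ⟨⟩-injective ur≈
              u′≈y = go y (rs (Step-below {x} step)) yu
          in ∈-respˡ x (≈-sym (≈-trans z≈ (≈-trans (val-cong G u≈) u′≈y))) y∈x

        include′ : x ⊆ val G v
        include′ y y∈x =
          let step : Step x y q
              step = inj₂ (lift y∈x , lift q∈k)
              (u , _ , lift yu , lift uq) = proj₂ (att x x∈M v v∈M (lift p))
                y (M-member y∈x x∈M) q (M-member q∈k k∈M) step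
          in ∈-respˡ (val G v) (go y (rs (Step-below {x} step)) yu) (val-intro G v uq q∈G)

    -- A single attempt defined at ⋃k already contains the check names of all points of ⋃k, because
    -- its domain is closed under steps. Any member q of G serves to activate them.
    union-name : ∃[ τ ] τ ∈ M × (∀ {G} → G ⊆ k → (∃[ q ] q ∈ G) → val G τ ≈ ⋃ᵛ G)
    union-name with recursion (⋃∈M k∈M)
    ... | g , g∈M , att , v , v∈M , lift kv∈g
      with relate nameᶠ name-sep {g ∷ []} (g∈M ∷ᴹ []ᴹ) {⋃ᵛ ⋃ᵛ g ∪ k} (∪∈M (⋃∈M (⋃∈M g∈M)) k∈M)
    ... | τ , τ∈M , _ , τ⇔ = τ , τ∈M , value
      where
      module _ {G} (G⊆k : G ⊆ k) (q : V) (q∈G : q ∈ G) where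
        inhabited : ∃[ q ] q ∈ k × q ∈ G
        inhabited = q , G⊆k q q∈G , q∈G

        include : val G τ ⊆ ⋃ᵛ G
        include z z∈ =
          let (u , p , up∈τ , p∈G , z≈) = val-elim G τ z∈
              (_ , _ , x , x∈p , lift xu) = to (τ⇔ u p) up∈τ
          in ∈-respˡ (⋃ᵛ G) (≈-sym (≈-trans z≈ (val-check g∈M att inhabited xu)))
               (from (∈-⋃ G) (p , p∈G , x∈p))

        include′ : ⋃ᵛ G ⊆ val G τ
        include′ x x∈⋃ =
          let (p , p∈G , x∈p) = to (∈-⋃ G) x∈⋃
              p∈k = G⊆k p p∈G
              x∈⋃k = from (∈-⋃ k) (p , p∈k , x∈p)
              (u , _ , lift xu , _) = proj₂ (att (⋃ᵛ k) (⋃∈M k∈M) v v∈M (lift kv∈g))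
                x (M-member x∈⋃k (⋃∈M k∈M)) q (M-member (G⊆k q q∈G) k∈M)
                (inj₂ (lift x∈⋃k , lift (G⊆k q q∈G)))
              up∈τ = from (τ⇔ u p) (∪ˡ k (proj₂ (field∈ g xu)) , ∪ʳ (⋃ᵛ ⋃ᵛ g) p∈k ,
                                    x , x∈p , lift xu)
          in ∈-respˡ (val G τ) (val-check g∈M att inhabited xu) (val-intro G τ up∈τ p∈G)

      value : ∀ {G} → G ⊆ k → (∃[ q ] q ∈ G) → val G τ ≈ ⋃ᵛ G
      value G⊆k (q , q∈G) = ≈-ext (include G⊆k q q∈G) (include′ G⊆k q q∈G)

-- Baire category

-- Cantor's walk along the antidiagonals; from (0 , b) it jumps to the start of the following one.
next : ℕ × ℕ → ℕ × ℕ
next (zero , b) = suc b , zero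
next (suc a , b) = a , suc b

unpair : ℕ → ℕ × ℕ
unpair zero = 0 , 0
unpair (suc n) = next (unpair n)

unpair-surjective : ∀ x → ∃[ n ] unpair n ≡ x
unpair-surjective (a , b) = reach (a ℕ.+ b) b a refl
  where
  reach : ∀ s b a → a ℕ.+ b ≡ s → ∃[ n ] unpair n ≡ (a , b)
  reach s (suc b) a e =
    let (n , p) = reach s b (suc a) (trans (sym (+-suc a b)) e) in suc n , cong next p
  reach (suc s) zero (suc a) e =
    let (n , p) = reach s a zero (trans (+-comm 0 a) (suc-injective e)) in suc n , cong next p
  reach s zero zero e = 0 , refl

module Category (em : ∀ {ℓ} → ExcludedMiddle ℓ) {M : V} (M-countable : Countable M) (ℙ : Poset) where
  open Poset ℙ
  open Generic using (filter; isFilter; generic)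
  open IsFilter using (subset; nonempty; upward; directed)

  ≤-resp : ∀ {p p′ q q′} → p ≈ p′ → q ≈ q′ → p ≤ q → p′ ≤ q′
  ≤-resp = ⟨⟩∈-resp order

  ≤-carrier : ∀ {p q} → p ≤ q → p ∈ carrier × q ∈ carrier
  ≤-carrier {p} {q} p≤q =
    let (p′ , q′ , p′∈ , q′∈ , e) = ≤-on-carrier ⟨ p , q ⟩ p≤q
        (p≈ , q≈) = ⟨⟩-injective e
    in ∈-respˡ carrier (≈-sym p≈) p′∈ , ∈-respˡ carrier (≈-sym q≈) q′∈

  meet : ∀ (G : Generic M ℙ) {p q} → p ∈ filter G → q ∈ filter G →
         ∃[ r ] r ∈ filter G × r ≤ p × r ≤ q
  meet G {p} {q} = directed (isFilter G) p q

  up : ∀ (G : Generic M ℙ) {p q} → p ∈ filter G → p ≤ q → q ∈ filter G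
  up G {p} {q} p∈G p≤q = upward (isFilter G) p q p∈G (proj₂ (≤-carrier p≤q)) p≤q

  -- Dense classes that need not be sets of M. Countably many of them describe a comeager set of
  -- generic filters.
  DensePred : (V → Set₁) → Set₁
  DensePred D = ∀ p → p ∈ carrier → ∃[ d ] d ≤ p × D d

  Meets : (ℕ → V → Set₁) → Generic M ℙ → Set₁
  Meets 𝒟 G = ∀ n → ∃[ p ] p ∈ filter G × 𝒟 n p

  module _ (𝒟 : ℕ → V → Set₁) (𝒟-dense : ∀ n → DensePred (𝒟 n)) {p₀} (p₀∈ : p₀ ∈ carrier) where

    private
      enum : ℕ → V
      enum = proj₁ M-countable

      -- One step treats the n-th class and the n-th enumerated set together; whether the latter is
      -- dense is settled by excluded middle. Neither is assumed to be closed downwards, so q only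
      -- has to lie below a member.
      refine : ∀ n p → p ∈ carrier →
               ∃[ q ] q ≤ p × (∃[ d ] q ≤ d × 𝒟 n d) × (Dense (enum n) → ∃[ d ] q ≤ d × d ∈ enum n)
      refine n p p∈ with 𝒟-dense n p p∈ | em {P = Dense (enum n)}
      ... | d , d≤p , Dd | yes dense =
        let (d′ , d′∈D , d′≤d) = proj₂ dense d (proj₁ (≤-carrier d≤p)) in
        d′ , ≤-trans d′ d p d′≤d d≤p , (d , d′≤d , Dd) ,
        λ _ → d′ , ≤-refl d′ (proj₁ (≤-carrier d′≤d)) , d′∈D
      ... | d , d≤p , Dd | no ¬dense =
        d , d≤p , (d , ≤-refl d (proj₁ (≤-carrier d≤p)) , Dd) , λ dense → ⊥-elim (¬dense dense)

      chain : ℕ → ∃[ p ] p ∈ carrier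
      chain zero = p₀ , p₀∈
      chain (suc n) = let (p , p∈) = chain n ; (q , q≤p , _) = refine n p p∈ in
        q , proj₁ (≤-carrier q≤p)

      _th : ℕ → V
      n th = proj₁ (chain n)

      descending : ∀ m n → (m ℕ.+ n) th ≤ n th
      descending zero n = ≤-refl (n th) (proj₂ (chain n))
      descending (suc m) n =
        ≤-trans (suc (m ℕ.+ n) th) ((m ℕ.+ n) th) (n th)
          (proj₁ (proj₂ (refine (m ℕ.+ n) ((m ℕ.+ n) th) (proj₂ (chain (m ℕ.+ n))))))
          (descending m n)

      -- The upward closure of the chain, indexed by the carrier so that it is again a set of V.
      G : V
      G = sup (Σ[ i ∈ Index carrier ] ∃[ n ] n th ≤ elem carrier i) λ (i , _) → elem carrier i

      G-intro : ∀ {q} n → n th ≤ q → q ∈ G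
      G-intro n n≤q =
        let (i , q≈) = proj₂ (≤-carrier n≤q) in
        (i , n , ≤-resp ≈-refl q≈ n≤q) , q≈

      G-elim : ∀ {q} → q ∈ G → ∃[ n ] n th ≤ q
      G-elim ((i , n , n≤q) , q≈) = n , ≤-resp ≈-refl (≈-sym q≈) n≤q

    abstract
      rasiowa-sikorski : Σ[ G ∈ Generic M ℙ ] p₀ ∈ filter G × Meets 𝒟 G
      rasiowa-sikorski = record
        { filter = G
        ; isFilter = record
          { subset = λ q q∈G → proj₂ (≤-carrier (proj₂ (G-elim q∈G)))
          ; nonempty = p₀ , p₀∈G
          ; upward = λ p q p∈G _ p≤q → let (n , n≤p) = G-elim p∈G in
              G-intro n (≤-trans (n th) p q n≤p p≤q)
          ; directed = λ p q p∈G q∈G →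
              let (m , m≤p) = G-elim p∈G ; (n , n≤q) = G-elim q∈G
                  r = (m ℕ.+ n) th
                  r≤m = subst (λ k → k th ≤ m th) (+-comm n m) (descending n m)
              in r , G-intro (m ℕ.+ n) (≤-refl r (proj₂ (chain (m ℕ.+ n)))) ,
                 ≤-trans r (m th) p r≤m m≤p , ≤-trans r (n th) q (descending m n) n≤q
          }
        ; generic = λ D D∈M dense →
            let (n , e) = proj₂ M-countable D D∈M
                dense′ : Dense (enum n)
                dense′ = (λ z z∈ → proj₁ dense z (≈⇒⊆ e z z∈)) ,
                         λ p p∈ → let (d , d∈D , d≤p) = proj₂ dense p p∈ in d , ≈⇒⊇ e d d∈D , d≤p
                (d , q≤d , d∈) = proj₂ (proj₂ (proj₂ (refine n (n th) (proj₂ (chain n))))) dense′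
            in d , G-intro (suc n) q≤d , ≈⇒⊆ e d d∈
        } , p₀∈G , λ n →
          let (d , q≤d , Dd) = proj₁ (proj₂ (proj₂ (refine n (n th) (proj₂ (chain n))))) in
          d , G-intro (suc n) q≤d , Dd
        where
        p₀∈G : p₀ ∈ G
        p₀∈G = G-intro 0 (≤-refl p₀ p₀∈)

  -- The property of Baire in the form: on a comeager set of generic filters,
  -- membership in U is decided by the conditions in the filter.

  Forces : (ℕ → V → Set₁) → V → Pred (Generic M ℙ) 0ℓ → Set₁
  Forces 𝒟 p U = ∀ H → p ∈ filter H → Meets 𝒟 H → U H

  record Baire (U : Pred (Generic M ℙ) 0ℓ) : Set₂ where
    field
      family : ℕ → V → Set₁
      family-dense : ∀ n → DensePred (family n)
      decide : ∀ G → Meets family G → U G → ∃[ p ] p ∈ filter G × Forces family p U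
      decide-∁ : ∀ G → Meets family G → ¬ U G → ∃[ p ] p ∈ filter G × Forces family p (∁ U)

  open Baire

  -- Deciding conditions are dense: if some filter through p lies in U, a basic neighbourhood of it
  -- inside U meets p in the filter; otherwise p itself excludes U.
  open-baire : ∀ {U} → GenOpen M ℙ U → Baire U
  open-baire {U} U-open = record
    { family = λ _ → Decides
    ; family-dense = λ _ → dense
    ; decide = λ G meets u → decided G u (meets 0)
    ; decide-∁ = λ G meets ¬u → decided-∁ G ¬u (meets 0)
    }
    where
    Decides : V → Set₁
    Decides p = (∀ H → p ∈ filter H → U H) ⊎ (∀ H → p ∈ filter H → ¬ U H)

    dense : DensePred Decides
    dense p p∈ with em {P = ∃[ H ] p ∈ filter H × U H}
    ... | yes (H , p∈H , u) =
      let (q , _ , q∈H , q⊩) = U-open H u ; (r , r∈H , r≤p , r≤q) = meet H p∈H q∈H in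
      r , r≤p , inj₁ λ K r∈K → q⊩ K (up K r∈K r≤q)
    ... | no none = p , ≤-refl p p∈ , inj₂ λ H p∈H u → none (H , p∈H , u)

    decided : ∀ G → U G → ∃[ p ] p ∈ filter G × Decides p →
              ∃[ p ] p ∈ filter G × Forces (λ _ → Decides) p U
    decided G u (p , p∈G , inj₁ f) = p , p∈G , λ H p∈H _ → f H p∈H
    decided G u (p , p∈G , inj₂ f) = ⊥-elim (f G p∈G u)

    decided-∁ : ∀ G → ¬ U G → ∃[ p ] p ∈ filter G × Decides p →
                ∃[ p ] p ∈ filter G × Forces (λ _ → Decides) p (∁ U)
    decided-∁ G ¬u (p , p∈G , inj₁ f) = ⊥-elim (¬u (f G p∈G))
    decided-∁ G ¬u (p , p∈G , inj₂ f) = p , p∈G , λ H p∈H _ → f H p∈H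

  ∁-baire : ∀ {U} → Baire U → Baire (∁ U)
  ∁-baire b = record
    { family = family b
    ; family-dense = family-dense b
    ; decide = decide-∁ b
    ; decide-∁ = λ G meets ¬¬u →
        let (p , p∈G , f) = decide b G meets (em⇒dne em ¬¬u) in
        p , p∈G , λ H p∈H m ¬u → ¬u (f H p∈H m)
    }

  module _ (𝒟 : ℕ → ℕ → V → Set₁) where

    abstract
      flatten : ℕ → V → Set₁
      flatten k = let (m , n) = unpair k in 𝒟 m n

      flatten-dense : (∀ m n → DensePred (𝒟 m n)) → ∀ k → DensePred (flatten k)
      flatten-dense dense k = let (m , n) = unpair k in dense m n

      flatten-meets : ∀ G → Meets flatten G → ∀ m → Meets (𝒟 m) G
      flatten-meets G meets m n =
        let (k , e) = unpair-surjective (m , n) in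
        subst (λ (m , n) → ∃[ p ] p ∈ filter G × 𝒟 m n p) e (meets k)

  _◂_ : ∀ {ℓ} {A : Set ℓ} → A → (ℕ → A) → ℕ → A
  (x ◂ f) zero = x
  (x ◂ f) (suc n) = f n

  -- The families of all U n are joined with one more dense class: conditions that force a
  -- particular U n, or that force the union to fail, over filters meeting all those families.
  ⋃-baire : ∀ (U : ℕ → Pred (Generic M ℙ) 0ℓ) → (∀ n → Baire (U n)) → Baire (⋃ ℕ U)
  ⋃-baire U b = record
    { family = flatten all
    ; family-dense = flatten-dense all λ { zero _ → dense ; (suc n) → family-dense (b n) }
    ; decide = λ G meets u → decided G meets u (flatten-meets all G meets 0 0)
    ; decide-∁ = λ G meets ¬u → decided-∁ G meets ¬u (flatten-meets all G meets 0 0)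
    }
    where
    MeetsAll : Generic M ℙ → Set₁
    MeetsAll H = ∀ n → Meets (family (b n)) H

    Decides : V → Set₁
    Decides p = (∃[ n ] ∀ H → p ∈ filter H → MeetsAll H → U n H) ⊎
                (∀ H → p ∈ filter H → MeetsAll H → ¬ ⋃ ℕ U H)

    all : ℕ → ℕ → V → Set₁
    all = (λ _ → Decides) ◂ λ n → family (b n)

    meetsAll : ∀ H → Meets (flatten all) H → MeetsAll H
    meetsAll H meets n = flatten-meets all H meets (suc n)

    dense : DensePred Decides
    dense p p∈ with em {P = ∃[ H ] p ∈ filter H × MeetsAll H × ⋃ ℕ U H}
    ... | yes (H , p∈H , m , n , u) =
      let (q , q∈H , f) = decide (b n) H (m n) u ; (r , r∈H , r≤p , r≤q) = meet H p∈H q∈H in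
      r , r≤p , inj₁ (n , λ K r∈K m → f K (up K r∈K r≤q) (m n))
    ... | no none = p , ≤-refl p p∈ , inj₂ λ H p∈H m u → none (H , p∈H , m , u)

    decided : ∀ G → Meets (flatten all) G → ⋃ ℕ U G → ∃[ p ] p ∈ filter G × Decides p →
              ∃[ p ] p ∈ filter G × Forces (flatten all) p (⋃ ℕ U)
    decided G meets u (p , p∈G , inj₁ (n , f)) = p , p∈G , λ H p∈H m → n , f H p∈H (meetsAll H m)
    decided G meets u (p , p∈G , inj₂ f) = ⊥-elim (f G p∈G (meetsAll G meets) u)

    decided-∁ : ∀ G → Meets (flatten all) G → ¬ ⋃ ℕ U G → ∃[ p ] p ∈ filter G × Decides p →
                ∃[ p ] p ∈ filter G × Forces (flatten all) p (∁ (⋃ ℕ U))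
    decided-∁ G meets ¬u (p , p∈G , inj₁ (n , f)) = ⊥-elim (¬u (n , f G p∈G (meetsAll G meets)))
    decided-∁ G meets ¬u (p , p∈G , inj₂ f) = p , p∈G , λ H p∈H m → f H p∈H (meetsAll H m)

  borel-baire : ∀ {U} → Borel (GenOpen M ℙ) U → Baire U
  borel-baire (opn U-open) = open-baire U-open
  borel-baire (comp β) = ∁-baire (borel-baire β)
  borel-baire (cup U β) = ⋃-baire U λ n → borel-baire (β n)
  borel-baire (resp (U⊆W , W⊆U) β) = let b = borel-baire β in record
    { family = family b
    ; family-dense = family-dense b
    ; decide = λ G meets w → let (p , p∈G , f) = decide b G meets (W⊆U w) in
        p , p∈G , λ H p∈H m → U⊆W (f H p∈H m)
    ; decide-∁ = λ G meets ¬w → let (p , p∈G , f) = decide-∁ b G meets (λ u → ¬w (U⊆W u)) in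
        p , p∈G , λ H p∈H m w → f H p∈H m (W⊆U w)
    }

-- Ergodicity below a homogeneous condition

module Criterion (em : ∀ {ℓ} → ExcludedMiddle ℓ) {M : V} (𝓜 : Model M)
                 (ℙ : Poset) (ℙ∈M : Poset.asSet ℙ ∈ M) where
  open Model 𝓜
  open ClosureProperties 𝓜
  open Poset ℙ
  open Generic using (filter; isFilter; generic)
  open IsFilter using (subset; nonempty; upward; directed)
  open Category em {M} M-countable ℙ
  open Baire
  open Names 𝓜

  carrier∈M : carrier ∈ M
  carrier∈M = proj₁ (components∈M ℙ∈M)

  -- Being its own inverse, e gets bijectivity from `symmetric` and `total`; functionality up to `≈`
  -- follows from `monotone` and antisymmetry of the order.
  record Involution : Set₁ where
    field
      e : V
      e∈M : e ∈ M
      total : ∀ {p} → p ∈ carrier → ∃[ q ] ⟨ p , q ⟩ ∈ e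
      symmetric : ∀ {p q} → ⟨ p , q ⟩ ∈ e → ⟨ q , p ⟩ ∈ e
      domain : ∀ {p q} → ⟨ p , q ⟩ ∈ e → p ∈ carrier
      monotone : ∀ {p p′ q q′} → ⟨ p , q ⟩ ∈ e → ⟨ p′ , q′ ⟩ ∈ e → p ≤ p′ → q ≤ q′

    codomain : ∀ {p q} → ⟨ p , q ⟩ ∈ e → q ∈ carrier
    codomain pq = domain (symmetric pq)

  module _ (ε : Involution) where
    open Involution ε

    private
      image : V → V
      image G = sup (Σ[ i ∈ Index carrier ] Σ[ j ∈ Index G ] ⟨ elem G j , elem carrier i ⟩ ∈ e)
                    λ (i , _) → elem carrier i

      image-intro : ∀ G {p q} → p ∈ G → ⟨ p , q ⟩ ∈ e → q ∈ image G
      image-intro G (j , p≈) pq = let (i , q≈) = codomain pq in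
        (i , j , ⟨⟩∈-resp e p≈ q≈ pq) , q≈

      image-elim : ∀ G {q} → q ∈ image G → ∃[ p ] p ∈ G × ⟨ p , q ⟩ ∈ e
      image-elim G ((i , j , pq) , q≈) =
        elem G j , elem∈ G j , ⟨⟩∈-resp e ≈-refl (≈-sym q≈) pq

    Pullback : (V → Set₁) → V → Set₁
    Pullback D p = ∃[ q ] ⟨ p , q ⟩ ∈ e × D q

    pullback-dense : ∀ {D} → DensePred D → DensePred (Pullback D)
    pullback-dense dense p p∈ =
      let (q , pq) = total p∈
          (d , d≤q , Dd) = dense q (codomain pq)
          (d′ , dd′) = total (proj₁ (≤-carrier d≤q))
      in d′ , monotone dd′ (symmetric pq) d≤q , d , symmetric dd′ , Dd

    translate : Generic M ℙ → Generic M ℙ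
    translate G = record
      { filter = image F
      ; isFilter = record
        { subset = λ q q∈ → codomain (proj₂ (proj₂ (image-elim F q∈)))
        ; nonempty = let (p , p∈F) = nonempty (isFilter G)
                         (q , pq) = total (subset (isFilter G) p p∈F)
                     in q , image-intro F p∈F pq
        ; upward = λ q q′ q∈ q′∈ q≤q′ →
            let (p , p∈F , pq) = image-elim F q∈
                (p′ , q′p′) = total q′∈
            in image-intro F (up G p∈F (monotone (symmetric pq) q′p′ q≤q′)) (symmetric q′p′)
        ; directed = λ q q′ q∈ q′∈ →
            let (p , p∈F , pq) = image-elim F q∈
                (p′ , p′∈F , p′q′) = image-elim F q′∈
                (r , r∈F , r≤p , r≤p′) = meet G p∈F p′∈F
                (s , rs) = total (subset (isFilter G) r r∈F)
            in s , image-intro F r∈F rs , monotone rs pq r≤p , monotone rs p′q′ r≤p′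
        }
      ; generic = λ D D∈M dense →
          -- Genericity passes to the image because e ∈ M: the preimage of D is again a dense set of
          -- M, so G meets it.
          let (D′ , D′∈M , D′⇔) = comprehend preimageᶠ preimage-sep (D ∷ e ∷ [])
                (D∈M ∷ᴹ e∈M ∷ᴹ []ᴹ) carrier carrier∈M
              dense′ : Dense D′
              dense′ = (λ p p∈ → proj₁ (to (D′⇔ p) p∈)) , λ p p∈ →
                let (d , d≤p , q , dq , q∈D) = pullback-dense {λ q → Lift _ (q ∈ D)}
                      (λ p p∈ → let (d , d∈D , d≤p) = proj₂ dense p p∈ in d , d≤p , lift d∈D) p p∈
                in d , from (D′⇔ d) (proj₁ (≤-carrier d≤p) , q , Lift.lower q∈D , lift dq) , d≤p
              (p , p∈F , p∈D′) = generic G D′ D′∈M dense′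
              (_ , q , q∈D , lift pq) = to (D′⇔ p) p∈D′
          in q , image-intro F p∈F pq , q∈D
      }
      where F = filter G

    translate-∈ : ∀ G {p q} → p ∈ filter G → ⟨ p , q ⟩ ∈ e → q ∈ filter (translate G)
    translate-∈ G = image-intro (filter G)

    -- Names are translated along e in both directions, as e is its own inverse.
    translate-same : ∀ G → SameExtension M ℙ G (translate G)
    translate-same G = ≈-ext
      (extension-⊆ e∈M {F} {image F}
        (λ p∈F → let (q , pq) = total (subset (isFilter G) _ p∈F) in q , image-intro F p∈F pq , pq)
        (λ q∈ pq → back q∈ (symmetric pq)))
      (extension-⊆ e∈M {image F} {F}
        (λ q∈ → let (p , p∈F , pq) = image-elim F q∈ in p , p∈F , symmetric pq)
        (λ p∈F qp → image-intro F p∈F (symmetric qp)))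
      where
      F = filter G
      back : ∀ {p q} → q ∈ image F → ⟨ q , p ⟩ ∈ e → p ∈ F
      back q∈ qp = let (p′ , p′∈F , p′q) = image-elim F q∈ in
        up G p′∈F (monotone (symmetric p′q) qp (≤-refl _ (codomain p′q)))

  -- By homogeneity every invariant Borel set is trivial on the comeager set
  -- of sufficiently generic filters below c₀, whereas the classes are
  -- countable and avoid makes them meager.

  module _ {c₀} (c₀∈ : c₀ ∈ carrier)
    (homogeneous : ∀ {p q} → p ≤ c₀ → q ≤ c₀ →
      Σ[ ε ∈ Involution ] ∃[ s ] ⟨ p , s ⟩ ∈ Involution.e ε × Compatible s q)
    {τ} (τ∈M : τ ∈ M)
    (avoid : ∀ y {p} → p ≤ c₀ →
      ∃[ q ] q ≤ p × (∀ (H : Generic M ℙ) → q ∈ filter H → ¬ val (filter H) τ ≈ y))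
    where

    Invariant : Pred (Generic M ℙ) 0ℓ → Set₁
    Invariant U = ∀ G H → SameExtension M ℙ G H → U G → U H

    -- If p ∈ G forces U and q ∈ H forces its complement, both strengthened below `c₀`, some ε makes
    -- the image s of p compatible with q. For r below s and q, a sufficiently generic K through the
    -- image of r has K in U and its translate outside U, although both generate the same extension.
    ergodic : ∀ {U} (b : Baire U) → Invariant U →
              ∀ G H → c₀ ∈ filter G → c₀ ∈ filter H → Meets (family b) G → Meets (family b) H →
              U G → U H
    ergodic {U} b invariant G H c₀∈G c₀∈H mG mH uG = em⇒dne em contradiction
      where
      -- Index 0 makes K itself generic enough for U; the pullbacks at the other indices do so for
      -- its translate.
      𝒟 : Involution → ℕ → ℕ → V → Set₁
      𝒟 ε = family b ◂ λ _ n → Pullback ε (family b n)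

      dense : ∀ ε m n → DensePred (𝒟 ε m n)
      dense ε zero = family-dense b
      dense ε (suc _) n = pullback-dense ε (family-dense b n)

      translate-meets : ∀ ε K → Meets (𝒟 ε 1) K → Meets (family b) (translate ε K)
      translate-meets ε K m n = let (d , d∈K , d′ , dd′ , Dd′) = m n in
        d′ , translate-∈ ε K d∈K dd′ , Dd′

      conflict : ∀ (ε : Involution) {p q r r′} → Forces (family b) p U → Forces (family b) q (∁ U) →
                 r ≤ q → r′ ≤ p → ⟨ r , r′ ⟩ ∈ Involution.e ε →
                 ¬ (Σ[ K ∈ Generic M ℙ ] r′ ∈ filter K × Meets (flatten (𝒟 ε)) K)
      conflict ε p⊩ q⊩ r≤q r′≤p rr′ (K , r′∈K , m) =
        q⊩ εK (up εK (translate-∈ ε K r′∈K (Involution.symmetric ε rr′)) r≤q)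
          (translate-meets ε K (flatten-meets (𝒟 ε) K m 1))
          (invariant K εK (translate-same ε K)
            (p⊩ K (up K r′∈K r′≤p) (flatten-meets (𝒟 ε) K m 0)))
        where
        εK : Generic M ℙ
        εK = translate ε K

      contradiction : ¬ ¬ U H
      contradiction ¬uH with decide b G mG uG | decide-∁ b H mH ¬uH
      ... | p , p∈G , p⊩U | q , q∈H , q⊩¬U with meet G p∈G c₀∈G | meet H q∈H c₀∈H
      ... | p′ , _ , p′≤p , p′≤c₀ | q′ , _ , q′≤q , q′≤c₀ with homogeneous p′≤c₀ q′≤c₀
      ... | ε , s , p′s , r , r∈ , r≤s , r≤q′ with Involution.total ε r∈
      ... | r′ , rr′ = conflict ε p⊩U q⊩¬U (≤-trans r q′ q r≤q′ q′≤q)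
        (≤-trans r′ p′ p (Involution.monotone ε rr′ (Involution.symmetric ε p′s) r≤s) p′≤p) rr′
        (rasiowa-sikorski (flatten (𝒟 ε)) (flatten-dense (𝒟 ε) (dense ε)) (Involution.codomain ε rr′))

    -- By ergodicity every sufficiently generic H through `c₀` would generate the extension of K.
    -- Yet H can also be made to avoid all values under K of the countably many names in M, so that
    -- its value of τ lies outside M[K].
    ergodic-family : (U : ℕ → Pred (Generic M ℙ) 0ℓ) → (∀ n → Baire (U n)) →
      (∀ n → Invariant (U n)) →
      ¬ (∀ G H → c₀ ∈ filter G → c₀ ∈ filter H → (∀ n → U n G → U n H) → SameExtension M ℙ G H)
    ergodic-family U b invariant separated =
      single-class (rasiowa-sikorski (flatten 𝒟₀) (flatten-dense 𝒟₀ dense₀) c₀∈)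
      where
      𝒟₀ : ℕ → ℕ → V → Set₁
      𝒟₀ n = family (b n)

      dense₀ : ∀ m n → DensePred (𝒟₀ m n)
      dense₀ m = family-dense (b m)

      -- Restricting to filters through `c₀` makes the class dense everywhere: conditions
      -- incompatible with `c₀` satisfy it vacuously.
      Avoids : V → V → Set₁
      Avoids y p = ∀ H → p ∈ filter H → c₀ ∈ filter H → ¬ val (filter H) τ ≈ y

      avoids-dense : ∀ y → DensePred (Avoids y)
      avoids-dense y p p∈ with em {P = Compatible p c₀}
      ... | yes (r , _ , r≤p , r≤c₀) =
        let (q , q≤r , f) = avoid y r≤c₀ in
        q , ≤-trans q r p q≤r r≤p , λ H q∈H _ → f H q∈H
      ... | no incompatible = p , ≤-refl p p∈ , λ H p∈H c₀∈H _ →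
        let (r , r∈H , r≤p , r≤c₀) = meet H p∈H c₀∈H in
        incompatible (r , subset (isFilter H) r r∈H , r≤p , r≤c₀)

      module _ (K : Generic M ℙ) where
        𝒟 : ℕ → ℕ → V → Set₁
        𝒟 = (λ n → Avoids (val (filter K) (proj₁ M-countable n))) ◂ 𝒟₀

        dense : ∀ m n → DensePred (𝒟 m n)
        dense zero n = avoids-dense (val (filter K) (proj₁ M-countable n))
        dense (suc m) = dense₀ m

        escapes : ∀ H → c₀ ∈ filter H → Meets (𝒟 0) H → ¬ SameExtension M ℙ K H
        escapes H c₀∈H m same
          with to (∈-extension M (filter K)) (≈⇒⊇ same (val (filter H) τ)
                 (from (∈-extension M (filter H)) (τ , τ∈M , ≈-refl)))
        ... | σ , σ∈M , e with proj₂ M-countable σ σ∈M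
        ... | n , σ≈ with m n
        ... | p , p∈H , avoids = avoids H p∈H c₀∈H (≈-trans e (val-cong (filter K) (≈-sym σ≈)))

        same-class : ∀ H → c₀ ∈ filter K → c₀ ∈ filter H →
                     Meets (flatten 𝒟₀) K → Meets (flatten 𝒟) H → SameExtension M ℙ K H
        same-class H c₀∈K c₀∈H mK mH = separated K H c₀∈K c₀∈H λ n →
          ergodic (b n) (invariant n) K H c₀∈K c₀∈H
            (flatten-meets 𝒟₀ K mK n) (flatten-meets 𝒟 H mH (suc n))

      single-class : ¬ (Σ[ K ∈ Generic M ℙ ] c₀ ∈ filter K × Meets (flatten 𝒟₀) K)
      single-class (K , c₀∈K , mK) with rasiowa-sikorski (flatten (𝒟 K)) (flatten-dense (𝒟 K) (dense K)) c₀∈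
      ... | H , c₀∈H , mH =
        escapes K H c₀∈H (flatten-meets (𝒟 K) H mH 0) (same-class K H c₀∈K c₀∈H mK mH)

-- A countable base of a Polish metric

split-gap : ∀ {r q} → r ℚ.< q → ∃[ ε ] 0ℚ ℚ.< ε × r ℚ.+ ε ≡ q
split-gap {r} {q} r<q = ε ,
  subst (ℚ._< ε) (ℚ.+-inverseˡ r) (ℚ.+-monoʳ-< (ℚ.- r) r<q) ,
  trans (sym (ℚ.+-assoc r (ℚ.- r) q))
    (trans (cong (ℚ._+ q) (ℚ.+-inverseʳ r)) (ℚ.+-identityˡ q))
  where
  ε : ℚ
  ε = ℚ.- r ℚ.+ q

halve : ∀ {q} → 0ℚ ℚ.< q → ∃[ ε ] 0ℚ ℚ.< ε × ε ℚ.+ ε ≡ q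
halve {q} 0<q = ½ ℚ.* q ,
  subst (ℚ._< ½ ℚ.* q) (ℚ.*-zeroʳ ½) (ℚ.*-monoʳ-<-pos ½ 0<q) ,
  trans (sym (ℚ.*-distribʳ-+ q ½ ½)) (ℚ.*-identityˡ q)

abstract
  -- An index codes a centre in the dense sequence and a radius i / (j + 1).
  decode : ℕ → ℕ × ℚ
  decode k = let (n , c) = unpair k ; (i , j) = unpair c in n , + i ℚ./ suc j

  decode-surjective : ∀ n q → 0ℚ ℚ.< q → ∃[ k ] decode k ≡ (n , q)
  decode-surjective n q@(mkℚ (+ i) j _) 0<q =
    let (c , c≡) = unpair-surjective (i , j) ; (k , k≡) = unpair-surjective (n , c) in
    k , trans (cong (λ (n , c) → n , + proj₁ (unpair c) ℚ./ suc (proj₂ (unpair c))) k≡)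
          (cong (n ,_) (trans (cong (λ (i , j) → + i ℚ./ suc j) c≡) (ℚ.↥p/↧p≡p q)))
  decode-surjective n q@(mkℚ -[1+ i ] j _) 0<q with positive 0<q
  ... | ()

module Balls {X : Setoid (lsuc 0ℓ) 0ℓ} (metric : PolishMetric X) where
  open Setoid X using () renaming (Carrier to |X|; _≈_ to _≈ₓ_)
  open PolishMetric metric

  About : Maybe |X| → ℚ → Pred |X| 0ℓ
  About (just d) q x = Near q d x
  About nothing q x = ⊥

  About-open : ∀ m q → Open (About m q)
  About-open (just d) q x x∈ =
    let (r , r<q , near) = rounded x∈ ; (ε , 0<ε , e) = split-gap r<q in
    ε , 0<ε , λ y x~y → subst (λ q → Near q d y) e (triangle near x~y)

  Ball : ℕ → Pred |X| 0ℓ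
  Ball k = let (n , q) = decode k in About (dense n) q

  Ball-open : ∀ k → Open (Ball k)
  Ball-open k = let (n , q) = decode k in About-open (dense n) q

  Ball-resp : ∀ k {x y} → x ≈ₓ y → Ball k x → Ball k y
  Ball-resp k {x} {y} x≈y x∈ =
    let (ε , 0<ε , near⇒) = Ball-open k x x∈ in near⇒ y (to (zero-iff x y) x≈y ε 0<ε)

  -- A ball of radius q/2 around a dense point near x contains x, hence y, which puts them within q
  -- of each other.
  Ball-separates : ∀ {x y} → (∀ k → Ball k x → Ball k y) → x ≈ₓ y
  Ball-separates {x} {y} h = from (zero-iff x y) λ q 0<q →
    let (ε , 0<ε , 2ε≡q) = halve 0<q
        (n , d , dense≡ , x~d) = separable x ε 0<ε
        (k , k≡) = decode-surjective n ε 0<ε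
    in subst (λ q → Near q x y) 2ε≡q
         (triangle x~d (near dense≡ k≡ (h k (ball dense≡ k≡ x~d))))
    where
    ball : ∀ {n d ε k} → dense n ≡ just d → decode k ≡ (n , ε) → Near ε x d → Ball k x
    ball dense≡ k≡ x~d rewrite k≡ | dense≡ = symm x~d

    near : ∀ {n d ε k} → dense n ≡ just d → decode k ≡ (n , ε) → Ball k y → Near ε d y
    near dense≡ k≡ y∈ rewrite k≡ | dense≡ = y∈

module _ (em : ∀ {ℓ} → ExcludedMiddle ℓ) {M : V} (M-countable : Countable M) (ℙ : Poset) where
  open Category em {M} M-countable ℙ

  -- The sets are the preimages of the basic balls: Borel because the reduction is, invariant
  -- because it respects the relation, separating because balls separate points.
  smooth⇒separating-family : Smooth (Gen M ℙ) (GenOpen M ℙ) (SameExtension M ℙ) →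
    Σ[ U ∈ (ℕ → Pred (Generic M ℙ) 0ℓ) ] (∀ n → Baire (U n)) ×
      (∀ n G H → SameExtension M ℙ G H → U n G → U n H) ×
      (∀ G H → (∀ n → U n G → U n H) → SameExtension M ℙ G H)
  smooth⇒separating-family (Y , f , measurable , reduces) =
    (λ n G → Ball n (Func.to f G)) ,
    (λ n → borel-baire (measurable (Ball n) (from (borel (Ball n)) (opn (Ball-open n))))) ,
    (λ n G H same → Ball-resp n (to (reduces G H) same)) ,
    (λ G H h → from (reduces G H) (Ball-separates h))
    where
    open StandardBorelSpace Y
    open Balls metric

-- The poset

singleton : V → V
singleton x = ⁅ x , x ⁆

∈-singleton : ∀ {x z} → z ∈ singleton x → z ≈ x
∈-singleton (true , p) = p
∈-singleton (false , p) = p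

numeral : ℕ → V
numeral zero = ∅ᵛ
numeral (suc n) = numeral n ∪ singleton (numeral n)

∈-numeral : ∀ {x} n → x ∈ numeral n → ∃[ m ] m ℕ.< n × x ≈ numeral m
∈-numeral {x} (suc n) x∈ with to (∈-∪ {numeral n} {singleton (numeral n)} {x}) x∈
... | inj₁ x∈n = let (m , m<n , e) = ∈-numeral n x∈n in m , m<n⇒m<1+n m<n , e
... | inj₂ x∈ = n , n<1+n n , ∈-singleton x∈

numeral-< : ∀ {m n} → m ℕ.< n → numeral m ∈ numeral n
numeral-< {m} {suc n} m<1+n with m<1+n⇒m<n∨m≡n m<1+n
... | inj₁ m<n = ∪ˡ (singleton (numeral n)) (numeral-< m<n)
... | inj₂ refl = ∪ʳ (numeral n) (elem∈ (singleton (numeral n)) true)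

numeral-injective : ∀ {m n} → numeral m ≈ numeral n → m ≡ n
numeral-injective {m} {n} e with <-cmp m n
... | tri< m<n _ _ = ⊥-elim (∈-irrefl (∈-respˡ (numeral n) e (numeral-< m<n)))
... | tri≈ _ m≡n _ = m≡n
... | tri> _ _ n<m = ⊥-elim (∈-irrefl (∈-respˡ (numeral m) (≈-sym e) (numeral-< n<m)))

-- The pair is {{x}}. A numeral equal to it would be nonzero and so contain ∅, which is no
-- singleton. This keeps the codes of the two bit values apart.
numeral≉⟨⟩ : ∀ n {x} → ¬ numeral n ≈ ⟨ x , x ⟩
numeral≉⟨⟩ n {x} e with ∈-numeral n (≈⇒⊇ e (singleton x) (elem∈ ⟨ x , x ⟩ true))
... | zero , _ , e′ = proj₁ (≈⇒⊆ e′ x (elem∈ (singleton x) true))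
... | suc m , m<n , e′ with ≈⇒⊆ e ∅ᵛ (numeral-< {0} {n} (m<n⇒0<n m<n))
... | true , p = proj₁ (≈⇒⊇ p x (elem∈ (singleton x) true))
... | false , p = proj₁ (≈⇒⊇ p x (elem∈ (singleton x) true))

point : ℕ → Bool → V
point m true = numeral m
point m false = ⟨ numeral m , numeral m ⟩

point-injective : ∀ {m n} b c → point m b ≈ point n c → m ≡ n × b ≡ c
point-injective true true e = numeral-injective e , refl
point-injective {m} true false e = ⊥-elim (numeral≉⟨⟩ m e)
point-injective {m} {n} false true e = ⊥-elim (numeral≉⟨⟩ n (≈-sym e))
point-injective {m} {n} false false e =
  numeral-injective (proj₁ (⟨⟩-injective {numeral m} {numeral m} {numeral n} {numeral n} e)) , refl

-- `conflictᶠ` singles out the point of the atom by its emptiness.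
point-empty : ∀ m b → (∀ z → ¬ z ∈ point m b) → m ≡ 0 × b ≡ true
point-empty zero true _ = refl , refl
point-empty (suc m) true h = ⊥-elim (h (numeral m) (numeral-< (n<1+n m)))
point-empty m false h = ⊥-elim (h (singleton (numeral m)) (elem∈ ⟨ numeral m , numeral m ⟩ true))

Partner : V → V → Set
Partner x y = y ≈ ⟨ x , x ⟩ ⊎ x ≈ ⟨ y , y ⟩

partner-point : ∀ m b → Partner (point m b) (point m (not b))
partner-point m true = inj₁ (≈-refl {point m false})
partner-point m false = inj₂ (≈-refl {point m false})

point-partner : ∀ {m n} b c → Partner (point m b) (point n c) → n ≡ m × c ≡ not b
point-partner {m} {n} true c (inj₁ e) = point-injective {n} {m} c false e
point-partner {m} {n} false true (inj₁ e) = ⊥-elim (numeral≉⟨⟩ n e)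
point-partner {m} {n} false false (inj₁ e) =
  ⊥-elim (numeral≉⟨⟩ n (proj₁ (⟨⟩-injective {numeral n} {numeral n} {point m false} {point m false} e)))
point-partner {m} {n} true c (inj₂ e) = ⊥-elim (numeral≉⟨⟩ m e)
point-partner {m} {n} false true (inj₂ e) =
  sym (proj₁ (point-injective {m} {n} false false e)) , refl
point-partner {m} {n} false false (inj₂ e) =
  ⊥-elim (numeral≉⟨⟩ m (proj₁ (⟨⟩-injective {numeral m} {numeral m} {point n false} {point n false} e)))

Partner-resp : ∀ {x x′ y y′} → x ≈ x′ → y ≈ y′ → Partner x y → Partner x′ y′
Partner-resp x≈ y≈ (inj₁ e) = inj₁ (≈-trans (≈-sym y≈) (≈-trans e (⟨⟩-cong x≈ x≈)))
Partner-resp x≈ y≈ (inj₂ e) = inj₂ (≈-trans (≈-sym x≈) (≈-trans e (⟨⟩-cong y≈ y≈)))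

-- The natural numbers of M

module Omega {M : V} (𝓜 : Model M) where
  open Model 𝓜
  open ClosureProperties 𝓜

  private
    Natural : V → Set₁
    Natural x = Sem M naturalᶠ (x ∷ [])

    zeroOrSuccessor : ∀ n {x} → x ≈ numeral n → Sem M (emptyᶠ 0F ∨̂ successorᶠ 0F) (x ∷ [])
    zeroOrSuccessor zero e = inj₁ λ z z∈x → ⊥-elim (proj₁ (≈⇒⊆ e z z∈x))
    zeroOrSuccessor (suc n) e = inj₂ (numeral n , ≈⇒⊇ e (numeral n) (numeral-< (n<1+n n)) ,
      (λ z z∈x → cases z (to (∈-∪ {numeral n} {singleton (numeral n)} {z}) (≈⇒⊆ e z z∈x))) ,
      λ z z∈n → lift (≈⇒⊇ e z (∪ˡ (singleton (numeral n)) z∈n)))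
      where
      cases : ∀ z → z ∈ numeral n ⊎ z ∈ singleton (numeral n) →
              Lift _ (z ∈ numeral n) ⊎ Lift _ (z ≈ numeral n)
      cases z (inj₁ p) = inj₁ (lift p)
      cases z (inj₂ p) = inj₂ (lift (∈-singleton p))

    numeral-natural : ∀ n → Natural (numeral n)
    numeral-natural n = zeroOrSuccessor n (≈-refl {numeral n}) , λ z z∈n →
      let (m , _ , e) = ∈-numeral n z∈n in zeroOrSuccessor m e

    -- The predecessor y of x is again natural, since its elements are elements of x;
    -- well-foundedness is that of V.
    natural-numeral : ∀ {x} → Acc _∈_ x → Natural x → ∃[ n ] x ≈ numeral n
    natural-numeral _ (inj₁ empty , _) =
      0 , ≈-ext (λ z z∈x → ⊥-elim (Lift.lower (empty z z∈x))) λ z ()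
    natural-numeral {x} (acc rs) (inj₂ (y , y∈x , x⊆ , y⊆x) , below) =
      let (n , e) = natural-numeral (rs y∈x) (below y y∈x , λ z z∈y → below z (Lift.lower (y⊆x z z∈y)))
      in suc n , ≈-ext
        (λ z z∈x → from (∈-∪ {numeral n} {singleton (numeral n)} {z}) (cases n e z (x⊆ z z∈x)))
        (λ z z∈ → cases′ n e z (to (∈-∪ {numeral n} {singleton (numeral n)} {z}) z∈))
      where
      cases : ∀ n → y ≈ numeral n → ∀ z → Lift _ (z ∈ y) ⊎ Lift _ (z ≈ y) →
              z ∈ numeral n ⊎ z ∈ singleton (numeral n)
      cases n e z (inj₁ (lift p)) = inj₁ (≈⇒⊆ e z p)
      cases n e z (inj₂ (lift p)) = inj₂ (true , ≈-trans p e)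
      cases′ : ∀ n → y ≈ numeral n → ∀ z → z ∈ numeral n ⊎ z ∈ singleton (numeral n) → z ∈ x
      cases′ n e z (inj₁ p) = Lift.lower (y⊆x z (≈⇒⊇ e z p))
      cases′ n e z (inj₂ p) = ∈-respˡ x (≈-sym (≈-trans (∈-singleton p) (≈-sym e))) y∈x

    numeral∈inductive : (w : Index M) →
      (∃[ e ] elem M e ∈ elem M w × ¬ (∃[ z ] elem M z ∈ elem M e)) →
      (∀ a → elem M a ∈ elem M w → ∃[ b ] elem M b ∈ elem M w × (∀ c →
        (elem M c ∈ elem M b → elem M c ∈ elem M a ⊎ elem M c ≈ elem M a) ×
        (elem M c ∈ elem M a ⊎ elem M c ≈ elem M a → elem M c ∈ elem M b))) →
      ∀ n → numeral n ∈ elem M w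
    numeral∈inductive w (e , e∈w , empty) _ zero = ∈-respˡ (elem M w)
      (≈-ext (λ z z∈e → let (c , z≈) = M-member z∈e (⟦⟧∈M e) in
                ⊥-elim (empty (c , ∈-respˡ (elem M e) z≈ z∈e)))
             λ z ())
      e∈w
    numeral∈inductive w zero∈ closed (suc n) =
      let (a , n≈a) = M-member n∈w (⟦⟧∈M w)
          (b , b∈w , b⇔) = closed a (∈-respˡ (elem M w) n≈a n∈w)
      in ∈-respˡ (elem M w) (≈-ext
        (λ z z∈b →
          let (c , z≈) = M-member z∈b (⟦⟧∈M b) in
          from (∈-∪ {numeral n} {singleton (numeral n)} {z})
            (cases n≈a z≈ (proj₁ (b⇔ c) (∈-respˡ (elem M b) z≈ z∈b))))
        (λ z z∈ → cases′ a b n≈a b⇔ z (to (∈-∪ {numeral n} {singleton (numeral n)} {z}) z∈)))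
        b∈w
      where
      n∈w : numeral n ∈ elem M w
      n∈w = numeral∈inductive w zero∈ closed n

      cases : ∀ {a c z} → numeral n ≈ elem M a → z ≈ elem M c →
              elem M c ∈ elem M a ⊎ elem M c ≈ elem M a → z ∈ numeral n ⊎ z ∈ singleton (numeral n)
      cases {a} {c} {z} n≈a z≈ (inj₁ p) = inj₁ (∈-respˡ (numeral n) (≈-sym z≈) (≈⇒⊇ n≈a (elem M c) p))
      cases n≈a z≈ (inj₂ p) = inj₂ (true , ≈-trans z≈ (≈-trans p (≈-sym n≈a)))

      cases′ : ∀ a b → numeral n ≈ elem M a →
               (∀ c → (elem M c ∈ elem M b → elem M c ∈ elem M a ⊎ elem M c ≈ elem M a) ×
                      (elem M c ∈ elem M a ⊎ elem M c ≈ elem M a → elem M c ∈ elem M b)) →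
               ∀ z → z ∈ numeral n ⊎ z ∈ singleton (numeral n) → z ∈ elem M b
      cases′ a b n≈a b⇔ z (inj₁ p) =
        let z∈a = ≈⇒⊆ n≈a z p ; (c , z≈) = M-member z∈a (⟦⟧∈M a) in
        ∈-respˡ (elem M b) (≈-sym z≈) (proj₂ (b⇔ c) (inj₁ (∈-respˡ (elem M a) z≈ z∈a)))
      cases′ a b n≈a b⇔ z (inj₂ p) =
        let z≈a = ≈-trans (∈-singleton p) n≈a in
        ∈-respˡ (elem M b) (≈-sym z≈a) (proj₂ (b⇔ a) (inj₂ ≈-refl))

  abstract
    omega : ∃[ ω ] ω ∈ M × (∀ x → x ∈ ω ⇔ (∃[ n ] x ≈ numeral n))
    omega =
      let (w , zero∈ , closed) = M-infinity
          (ω , ω∈M , ω⇔) = comprehend naturalᶠ natural-sep [] []ᴹ (elem M w) (⟦⟧∈M w)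
          n∈ω : ∀ n → numeral n ∈ ω
          n∈ω n = from (ω⇔ (numeral n)) (numeral∈inductive w zero∈ closed n , numeral-natural n)
      in ω , ω∈M , λ x → mk⇔
        (λ x∈ω → natural-numeral (∈-wellFounded x) (proj₂ (to (ω⇔ x) x∈ω)))
        (λ (n , e) → ∈-respˡ ω (≈-sym e) (n∈ω n))

-- The conditions and their order

module Forcing {M : V} (𝓜 : Model M) where
  open Model 𝓜
  open ClosureProperties 𝓜

  Bounded : ℕ → V → Set₁
  Bounded n p = ∀ x → x ∈ p → ∃[ m ] m ℕ.< n × ∃[ b ] x ≈ point m b

  Consistent : V → Set
  Consistent p = (∀ m b → point m b ∈ p → ¬ point m (not b) ∈ p) ×
                 (point 0 true ∈ p → ∀ m b → point m b ∈ p → m ≡ 0 × b ≡ true)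

  Condition : V → Set₁
  Condition p = p ∈ M × (∃[ n ] Bounded n p) × Consistent p

  Bounded-mono : ∀ {m n p} → m ℕ.≤ n → Bounded m p → Bounded n p
  Bounded-mono m≤n bd x x∈p = let (k , k<m , b , e) = bd x x∈p in k , <-≤-trans k<m m≤n , b , e

  private
    ω = proj₁ (Omega.omega 𝓜)
    ω∈M = proj₁ (proj₂ (Omega.omega 𝓜))
    ω⇔ = proj₂ (proj₂ (Omega.omega 𝓜))

  numeral∈ω : ∀ n → numeral n ∈ ω
  numeral∈ω n = from (ω⇔ (numeral n)) (n , ≈-refl)

  numeral∈M : ∀ n → numeral n ∈ M
  numeral∈M n = M-member (numeral∈ω n) ω∈M

  point∈M : ∀ m b → point m b ∈ M
  point∈M m true = numeral∈M m
  point∈M m false = ⟨⟩∈M (numeral∈M m) (numeral∈M m)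

  private
    Conditionᶠ : V → Set₁
    Conditionᶠ p = Sem M conditionᶠ (p ∷ ω ∷ [])

    Conflict : V → V → Set₁
    Conflict x y = Sem M (conflictᶠ 1F 0F) (y ∷ x ∷ [])

    Conflict-resp : ∀ {x x′ y y′} → x ≈ x′ → y ≈ y′ → x ∈ M → y ∈ M → Conflict x y → Conflict x′ y′
    Conflict-resp {x} {x′} {y} {y′} x≈ y≈ x∈M y∈M =
      Sem-resp (conflictᶠ 1F 0F) (y ∷ x ∷ []) (y′ ∷ x′ ∷ []) (y∈M ∷ᴹ x∈M ∷ᴹ []ᴹ)
        λ { 0F → ≈-sym y≈ ; 1F → ≈-sym x≈ }

    clash : ∀ {p} → Consistent p → ∀ {m b n c} → point m b ∈ p → point n c ∈ p →
            ¬ Conflict (point m b) (point n c)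
    clash (excl , atom) {m} {true} {n} {c} mp np (inj₁ (lift e))
      with point-injective {n} {m} c false e
    ... | refl , refl = excl n true mp np
    clash _ {m} {false} {n} {true} mp np (inj₁ (lift e)) = numeral≉⟨⟩ n e
    clash _ {m} {false} {n} {false} mp np (inj₁ (lift e)) =
      numeral≉⟨⟩ n (proj₁ (⟨⟩-injective {numeral n} {numeral n} {point m false} {point m false} e))
    clash (excl , atom) {m} {b} {n} {c} mp np (inj₂ (empty , nonempty))
      with point-empty m b (λ z z∈ → Lift.lower (empty z z∈))
    ... | refl , refl with atom mp n c np
    ... | refl , refl = Lift.lower (nonempty λ z ())

    no-conflict⇒consistent : ∀ {p} →
      (∀ {m b n c} → point m b ∈ p → point n c ∈ p → ¬ Conflict (point m b) (point n c)) →
      Consistent p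
    no-conflict⇒consistent {p} h = exclusive , atomic
      where
      exclusive : ∀ m b → point m b ∈ p → ¬ point m (not b) ∈ p
      exclusive m true mp mp′ = h {m} {true} {m} {false} mp mp′ (inj₁ (lift (≈-refl {point m false})))
      exclusive m false mp mp′ = h {m} {true} {m} {false} mp′ mp (inj₁ (lift (≈-refl {point m false})))

      atomic : point 0 true ∈ p → ∀ m b → point m b ∈ p → m ≡ 0 × b ≡ true
      atomic 0p zero true mp = refl , refl
      atomic 0p (suc m) true mp = ⊥-elim (h {0} {true} {suc m} {true} 0p mp (inj₂ ((λ z ()) ,
        λ empty → empty (numeral m) (numeral-< (n<1+n m)))))
      atomic 0p m false mp = ⊥-elim (h {0} {true} {m} {false} 0p mp (inj₂ ((λ z ()) ,
        λ empty → empty (singleton (numeral m)) (elem∈ (point m false) true))))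

    Conditionᶠ⇒ : ∀ {p} → p ∈ M → Conditionᶠ p → Condition p
    Conditionᶠ⇒ {p} p∈M ((n′ , n′∈ω , bounded) , consistent) =
      p∈M ,
      (n , λ x x∈p → decode-bound x (bounded x x∈p)) ,
      no-conflict⇒consistent {p} λ {m} {b} {k} {c} mp kp conflict →
        Lift.lower (consistent (point m b) mp (point k c) kp conflict)
      where
      n = proj₁ (to (ω⇔ n′) n′∈ω)
      n′≈ = proj₂ (to (ω⇔ n′) n′∈ω)
      decode-bound : ∀ x → ∃[ m ] m ∈ n′ × (Lift _ (x ≈ m) ⊎ Lift _ (x ≈ ⟨ m , m ⟩)) →
                     ∃[ m ] m ℕ.< n × ∃[ b ] x ≈ point m b
      decode-bound x (m′ , m′∈ , inj₁ (lift e)) =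
        let (m , m<n , e′) = ∈-numeral n (≈⇒⊆ n′≈ m′ m′∈) in
        m , m<n , true , ≈-trans e e′
      decode-bound x (m′ , m′∈ , inj₂ (lift e)) =
        let (m , m<n , e′) = ∈-numeral n (≈⇒⊆ n′≈ m′ m′∈) in
        m , m<n , false , ≈-trans e (⟨⟩-cong {m′} {m′} {numeral m} {numeral m} e′ e′)

    ⇒Conditionᶠ : ∀ {p} → Condition p → Conditionᶠ p
    ⇒Conditionᶠ {p} (p∈M , (n , bounded) , consistent) =
      (numeral n , numeral∈ω n , λ x x∈p → encode-bound x (bounded x x∈p)) ,
      λ x x∈p y y∈p conflict →
        let (m , _ , b , x≈) = bounded x x∈p ; (k , _ , c , y≈) = bounded y y∈p in
        lift (clash {p} consistent {m} {b} {k} {c} (∈-respˡ p x≈ x∈p) (∈-respˡ p y≈ y∈p)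
          (Conflict-resp {x} {point m b} {y} {point k c} x≈ y≈
            (M-member x∈p p∈M) (M-member y∈p p∈M) conflict))
      where
      encode-bound : ∀ x → ∃[ m ] m ℕ.< n × ∃[ b ] x ≈ point m b →
                     ∃[ m ] m ∈ numeral n × (Lift _ (x ≈ m) ⊎ Lift _ (x ≈ ⟨ m , m ⟩))
      encode-bound x (m , m<n , true , e) = numeral m , numeral-< m<n , inj₁ (lift e)
      encode-bound x (m , m<n , false , e) = numeral m , numeral-< m<n , inj₂ (lift e)

  abstract
    conditions : ∃[ K ] K ∈ M × (∀ p → p ∈ K ⇔ Condition p)
    conditions =
      -- Points are numerals or pairs of a numeral with itself, so conditions are found among the
      -- subsets of ω ∪ s.
      let (s , s∈M , ⟨⟩∈s) = square ω∈M
          (P , P∈M , P⇔) = power (∪∈M ω∈M s∈M)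
          (K , K∈M , K⇔) = comprehend conditionᶠ condition-sep (ω ∷ []) (ω∈M ∷ᴹ []ᴹ) P P∈M
          point∈ : ∀ {x} → ∃[ m ] ∃[ b ] x ≈ point m b → x ∈ ω ∪ s
          point∈ = λ { (m , true , e) → ∪ˡ s (∈-respˡ ω (≈-sym e) (numeral∈ω m))
                     ; (m , false , e) → ∪ʳ ω (∈-respˡ s (≈-sym e) (⟨⟩∈s (numeral∈ω m) (numeral∈ω m))) }
      in K , K∈M , λ p → mk⇔
        (λ p∈K → let (p∈P , c) = to (K⇔ p) p∈K in Conditionᶠ⇒ (proj₁ (to (P⇔ p) p∈P)) c)
        (λ c@(p∈M , (n , bounded) , _) → from (K⇔ p)
          (from (P⇔ p) (p∈M , λ x x∈p → let (m , _ , b , e) = bounded x x∈p in point∈ (m , b , e)) ,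
           ⇒Conditionᶠ c))

  private
    K = proj₁ conditions
    K∈M = proj₁ (proj₂ conditions)

  condition : ∀ {p} → p ∈ K ⇔ Condition p
  condition {p} = proj₂ (proj₂ conditions) p

  private
    extension : ∃[ o ] o ∈ M × (∀ z → z ∈ o → ∃[ p ] ∃[ q ] p ∈ K × q ∈ K × z ≈ ⟨ p , q ⟩) ×
      (∀ p q → ⟨ p , q ⟩ ∈ o ⇔ (p ∈ K × q ∈ K × Sem M extendsᶠ (q ∷ p ∷ ⟨ p , q ⟩ ∷ K ∷ [])))
    extension = relate extendsᶠ extends-sep []ᴹ K∈M

    o = proj₁ extension

  extends : ∀ {p q} → ⟨ p , q ⟩ ∈ o ⇔ (p ∈ K × q ∈ K × q ⊆ p)
  extends {p} {q} = mk⇔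
    (λ pq → let (p∈ , q∈ , h) = to (proj₂ (proj₂ (proj₂ extension)) p q) pq in
      p∈ , q∈ , λ z z∈q → Lift.lower (h z z∈q))
    (λ (p∈ , q∈ , h) → from (proj₂ (proj₂ (proj₂ extension)) p q) (p∈ , q∈ , λ z z∈q → lift (h z z∈q)))

  ℙ : Poset
  ℙ = record
    { carrier = K
    ; order = o
    ; ≤-on-carrier = proj₁ (proj₂ (proj₂ extension))
    ; ≤-refl = λ p p∈ → from extends (p∈ , p∈ , λ z z∈ → z∈)
    ; ≤-trans = λ p q r pq qr →
        let (p∈ , _ , q⊆p) = to extends pq ; (_ , r∈ , r⊆q) = to extends qr in
        from extends (p∈ , r∈ , λ z z∈ → q⊆p z (r⊆q z z∈))
    ; ≤-antisym = λ p q pq qp →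
        let (_ , _ , q⊆p) = to extends pq ; (_ , _ , p⊆q) = to extends qp in ≈-ext p⊆q q⊆p
    }

  ℙ∈M : Poset.asSet ℙ ∈ M
  ℙ∈M = ⟨⟩∈M K∈M (proj₁ (proj₂ extension))

-- Flipping finitely many bits

module Symmetry (em : ∀ {ℓ} → ExcludedMiddle ℓ) {M : V} (𝓜 : Model M) where
  open Model 𝓜
  open ClosureProperties 𝓜
  open Forcing 𝓜
  open Poset ℙ
  open Criterion em 𝓜 ℙ ℙ∈M

  point-singleton : ∀ {m n} b c → point m b ∈ singleton (point n c) → m ≡ n × b ≡ c
  point-singleton b c p = point-injective b c (∈-singleton p)

  fresh : ∀ {n m b p} → Bounded n p → n ℕ.≤ m → ¬ point m b ∈ p
  fresh {n} {m} {b} bounded n≤m mp with bounded (point m b) mp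
  ... | k , k<n , c , e with point-injective {m} {k} b c e
  ... | refl , _ = <-irrefl refl (<-≤-trans k<n n≤m)

  singleton-condition : ∀ m b → Condition (singleton (point m b))
  singleton-condition m b = pair∈M (point∈M m b) (point∈M m b) ,
    (suc m , λ x x∈ → m , n<1+n m , b , ∈-singleton x∈) , exclusive , atomic
    where
    exclusive : ∀ k c → point k c ∈ singleton (point m b) → ¬ point k (not c) ∈ singleton (point m b)
    exclusive k c p p′ = not-¬ refl (trans (proj₂ (point-singleton {k} {m} c b p))
                                          (sym (proj₂ (point-singleton {k} {m} (not c) b p′))))

    atomic : point 0 true ∈ singleton (point m b) → ∀ k c → point k c ∈ singleton (point m b) →
             k ≡ 0 × c ≡ true
    atomic p k c p′ with point-singleton {0} {m} true b p | point-singleton {k} {m} c b p′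
    ... | refl , refl | refl , refl = refl , refl

  ∪-bounded : ∀ {m n} p q → Bounded m p → Bounded n q → Bounded (m ℕ.⊔ n) (p ∪ q)
  ∪-bounded {m} {n} p q bp bq x x∈ with to (∈-∪ {p} {q} {x}) x∈
  ... | inj₁ x∈p = Bounded-mono {p = p} (m≤m⊔n m n) bp x x∈p
  ... | inj₂ x∈q = Bounded-mono {p = q} (m≤n⊔m m n) bq x x∈q

  ∪-condition : ∀ {p q} → Condition p → Condition q →
                (∀ m b → point m b ∈ p → ¬ point m (not b) ∈ q) →
                ¬ point 0 true ∈ p → ¬ point 0 true ∈ q → Condition (p ∪ q)
  ∪-condition {p} {q} (p∈M , (m , bp) , exclᵖ , _) (q∈M , (n , bq) , exclᵠ , _) excl 0∉p 0∉q =
    ∪∈M p∈M q∈M , (m ℕ.⊔ n , ∪-bounded p q bp bq) ,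
    (λ k b kb kb′ → exclusive k b (to (∈-∪ {p} {q} {point k b}) kb)
                                  (to (∈-∪ {p} {q} {point k (not b)}) kb′)) ,
    λ 0∈ → ⊥-elim (absurd (to (∈-∪ {p} {q} {point 0 true}) 0∈))
    where
    exclusive : ∀ k b → point k b ∈ p ⊎ point k b ∈ q → ¬ (point k (not b) ∈ p ⊎ point k (not b) ∈ q)
    exclusive k b (inj₁ kp) (inj₁ kp′) = exclᵖ k b kp kp′
    exclusive k b (inj₁ kp) (inj₂ kq) = excl k b kp kq
    exclusive k b (inj₂ kq) (inj₁ kp) =
      excl k (not b) kp (subst (λ b → point k b ∈ q) (sym (not-involutive b)) kq)
    exclusive k b (inj₂ kq) (inj₂ kq′) = exclᵠ k b kq kq′

    absurd : ¬ (point 0 true ∈ p ⊎ point 0 true ∈ q)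
    absurd (inj₁ 0p) = 0∉p 0p
    absurd (inj₂ 0q) = 0∉q 0q

  -- The new bit is n + 1 rather than n, because n may be 0 and the point 0 is reserved for the
  -- atom.
  extend : ∀ {n p} b → Condition p → Bounded n p → ¬ point 0 true ∈ p →
           Condition (p ∪ singleton (point (suc n) b))
  extend {n} {p} b c bounded 0∉p = ∪-condition c (singleton-condition (suc n) b)
    (λ m b′ mp mn → new m b′ mp (proj₁ (point-singleton {m} {suc n} (not b′) b mn)))
    0∉p (λ 0∈ → zero≢suc (proj₁ (point-singleton {0} {suc n} true b 0∈)))
    where
    new : ∀ m b′ → point m b′ ∈ p → m ≢ suc n
    new m b′ mp refl = fresh {n} {suc n} {b′} {p} bounded (n≤1+n n) mp
    zero≢suc : ∀ {k} → 0 ≢ suc k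
    zero≢suc ()

  -- D holds both values of each bit to be flipped. Sparing bit 0 is what makes the flip respect the
  -- atom.
  module Flip {D} (D∈M : D ∈ M) {d} (D-bounded : Bounded d D)
    (D-closed : ∀ m b → point m b ∈ D → point m (not b) ∈ D)
    (0∉D : ∀ b → ¬ point 0 b ∈ D) where

    Flipped : V → ℕ → Bool → Set
    Flipped p m b = (point m b ∈ D × point m (not b) ∈ p) ⊎ ((¬ point m b ∈ D) × point m b ∈ p)

    IsFlip : V → V → Set
    IsFlip p q = ∀ m b → point m b ∈ q ⇔ Flipped p m b

    private
      Flippedᶠ : V → V → Set₁
      Flippedᶠ p x = Sem M (flippedᶠ {3} 1F 2F 0F) (x ∷ D ∷ p ∷ [])

      Flippedᶠ⇒ : ∀ {n p x m b} → Bounded n p → x ≈ point m b → Flippedᶠ p x → Flipped p m b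
      Flippedᶠ⇒ {n} {p} {x} {m} {b} bounded x≈ (inj₁ (lift x∈D , y , y∈p , partner)) =
        inj₁ (∈-respˡ D x≈ x∈D , y-point (bounded y y∈p))
        where
        partner′ : Partner x y
        partner′ = Data.Sum.Base.map Lift.lower Lift.lower partner
        y-point : ∃[ k ] k ℕ.< n × ∃[ c ] y ≈ point k c → point m (not b) ∈ p
        y-point (k , _ , c , y≈) with point-partner {m} {k} b c (Partner-resp x≈ y≈ partner′)
        ... | refl , refl = ∈-respˡ p y≈ y∈p
      Flippedᶠ⇒ {p = p} bounded x≈ (inj₂ (x∉D , lift x∈p)) =
        inj₂ ((λ m∈D → Lift.lower (x∉D (lift (∈-respˡ D (≈-sym x≈) m∈D)))) , ∈-respˡ p x≈ x∈p)

      ⇒Flippedᶠ : ∀ {p x m b} → x ≈ point m b → Flipped p m b → Flippedᶠ p x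
      ⇒Flippedᶠ {p} {x} {m} {b} x≈ (inj₁ (m∈D , m∈p)) =
        inj₁ (lift (∈-respˡ D (≈-sym x≈) m∈D) , point m (not b) , m∈p ,
          Data.Sum.Base.map lift lift
            (Partner-resp (≈-sym x≈) (≈-refl {point m (not b)}) (partner-point m b)))
      ⇒Flippedᶠ {p} x≈ (inj₂ (m∉D , m∈p)) =
        inj₂ ((λ (lift x∈D) → lift (m∉D (∈-respˡ D x≈ x∈D))) , lift (∈-respˡ p (≈-sym x≈) m∈p))

      flip-graph : ∃[ e ] e ∈ M × (∀ z → z ∈ e → ∃[ p ] ∃[ q ] p ∈ carrier × q ∈ carrier × z ≈ ⟨ p , q ⟩) ×
        (∀ p q → ⟨ p , q ⟩ ∈ e ⇔ (p ∈ carrier × q ∈ carrier ×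
          Sem M flipᶠ (q ∷ p ∷ ⟨ p , q ⟩ ∷ carrier ∷ D ∷ [])))
      flip-graph = relate flipᶠ flip-sep {D ∷ []} (D∈M ∷ᴹ []ᴹ) carrier∈M

    e : V
    e = proj₁ flip-graph

    ∈-flip : ∀ {p q} → ⟨ p , q ⟩ ∈ e ⇔ (p ∈ carrier × q ∈ carrier × IsFlip p q)
    ∈-flip {p} {q} = mk⇔ forth back
      where
      graph⇔ = proj₂ (proj₂ (proj₂ flip-graph)) p q

      forth : ⟨ p , q ⟩ ∈ e → p ∈ carrier × q ∈ carrier × IsFlip p q
      forth pq with to graph⇔ pq
      ... | p∈ , q∈ , h with to condition p∈
      ... | _ , (n , bounded) , _ = p∈ , q∈ , λ m b → mk⇔
        (λ m∈q → Flippedᶠ⇒ {n} {p} {point m b} {m} {b} bounded (≈-refl {point m b})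
          (proj₁ (h (point m b) (point∈M m b)) (lift m∈q)))
        (λ fl → Lift.lower (proj₂ (h (point m b) (point∈M m b))
          (⇒Flippedᶠ {p} {point m b} {m} {b} (≈-refl {point m b}) fl)))

      back : p ∈ carrier × q ∈ carrier × IsFlip p q → ⟨ p , q ⟩ ∈ e
      back (p∈ , q∈ , fl) with to condition p∈ | to condition q∈
      ... | p∈M , (n , bp) , _ | q∈M , (k , bq) , _ = from graph⇔ (p∈ , q∈ , λ x x∈M →
        (λ (lift x∈q) → let (m , _ , b , x≈) = bq x x∈q in
          ⇒Flippedᶠ {p} {x} {m} {b} x≈ (to (fl m b) (∈-respˡ q x≈ x∈q))) ,
        λ f → let (m , b , x≈) = x-point x f in
          lift (∈-respˡ q (≈-sym x≈) (from (fl m b) (Flippedᶠ⇒ {n} {p} {x} {m} {b} bp x≈ f))))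
        where
        x-point : ∀ x → Flippedᶠ p x → ∃[ m ] ∃[ b ] x ≈ point m b
        x-point x (inj₁ (lift x∈D , _)) = let (m , _ , b , x≈) = D-bounded x x∈D in m , b , x≈
        x-point x (inj₂ (_ , lift x∈p)) = let (m , _ , b , x≈) = bp x x∈p in m , b , x≈

    flip-exclusive : ∀ {p q} → Condition p → IsFlip p q → ∀ m b →
                     point m b ∈ q → ¬ point m (not b) ∈ q
    flip-exclusive {p} (_ , _ , excl , _) fl m b mq mq′ with to (fl m b) mq | to (fl m (not b)) mq′
    ... | inj₁ (_ , m∈p) | inj₁ (_ , m∈p′) = excl m (not b) m∈p m∈p′
    ... | inj₁ (m∈D , _) | inj₂ (m∉D , _) = m∉D (D-closed m b m∈D)
    ... | inj₂ (m∉D , _) | inj₁ (m∈D , _) =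
      m∉D (subst (λ b → point m b ∈ D) (not-involutive b) (D-closed m (not b) m∈D))
    ... | inj₂ (_ , m∈p) | inj₂ (_ , m∈p′) = excl m b m∈p m∈p′

    flip-atomic : ∀ {p q} → Condition p → IsFlip p q →
                  point 0 true ∈ q → ∀ m b → point m b ∈ q → m ≡ 0 × b ≡ true
    flip-atomic {p} (_ , _ , excl , atom) fl 0q m b mq with to (fl 0 true) 0q | to (fl m b) mq
    ... | inj₁ (0∈D , _) | _ = ⊥-elim (0∉D true 0∈D)
    ... | inj₂ (_ , 0p) | inj₂ (_ , mp) = atom 0p m b mp
    -- A flipped point of q comes from its partner in p, which the atom forces to be at bit 0,
    -- outside D.
    ... | inj₂ (_ , 0p) | inj₁ (m∈D , mp) with atom 0p m (not b) mp
    ...   | refl , _ = ⊥-elim (0∉D b m∈D)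

    flip : ∀ {p} → Condition p → ∃[ q ] Condition q × IsFlip p q
    flip {p} c@(p∈M , (n , bounded) , _)
      with comprehend (flippedᶠ {3} 1F 2F 0F) flipped-sep (D ∷ p ∷ []) (D∈M ∷ᴹ p∈M ∷ᴹ []ᴹ) (D ∪ p) (∪∈M D∈M p∈M)
    ... | q , q∈M , q⇔ = q , (q∈M , (d ℕ.⊔ n , q-bounded) , flip-exclusive {p} {q} c fl , flip-atomic {p} {q} c fl) , fl
      where
      q-bounded : Bounded (d ℕ.⊔ n) q
      q-bounded x x∈q = ∪-bounded D p D-bounded bounded x (proj₁ (to (q⇔ x) x∈q))

      member : ∀ m b → Flipped p m b → point m b ∈ D ∪ p
      member m b (inj₁ (m∈D , _)) = ∪ˡ p m∈D
      member m b (inj₂ (_ , m∈p)) = ∪ʳ D m∈p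

      fl : IsFlip p q
      fl m b = mk⇔
        (λ mq → Flippedᶠ⇒ {n} {p} {point m b} {m} {b} bounded (≈-refl {point m b})
          (proj₂ (to (q⇔ (point m b)) mq)))
        (λ f → from (q⇔ (point m b))
          (member m b f , ⇒Flippedᶠ {p} {point m b} {m} {b} (≈-refl) f))

    flip-symmetric : ∀ {p q} → IsFlip p q → IsFlip q p
    flip-symmetric {p} {q} fl m b = mk⇔ forth back
      where
      forth : point m b ∈ p → Flipped q m b
      forth mp with em {P = point m b ∈ D}
      ... | yes m∈D = inj₁ (m∈D , from (fl m (not b))
        (inj₁ (D-closed m b m∈D , subst (λ b → point m b ∈ p) (sym (not-involutive b)) mp)))
      ... | no m∉D = inj₂ (m∉D , from (fl m b) (inj₂ (m∉D , mp)))

      back : Flipped q m b → point m b ∈ p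
      back (inj₁ (m∈D , mq)) with to (fl m (not b)) mq
      ... | inj₁ (_ , mp) = subst (λ b → point m b ∈ p) (not-involutive b) mp
      ... | inj₂ (m∉D , _) = ⊥-elim (m∉D (D-closed m b m∈D))
      back (inj₂ (m∉D , mq)) with to (fl m b) mq
      ... | inj₁ (m∈D , _) = ⊥-elim (m∉D m∈D)
      ... | inj₂ (_ , mp) = mp

    flip-monotone : ∀ {p p′ q q′} → q′ ∈ carrier → IsFlip p q → IsFlip p′ q′ → p′ ⊆ p → q′ ⊆ q
    flip-monotone {p} {p′} {q} {q′} q′∈ fl fl′ p′⊆p z z∈q′ with proj₁ (proj₂ (to condition q′∈))
    ... | n , bounded with bounded z z∈q′
    ... | m , _ , b , z≈ = ∈-respˡ q (≈-sym z≈) (from (fl m b) (mono (to (fl′ m b) (∈-respˡ q′ z≈ z∈q′))))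
      where
      mono : Flipped p′ m b → Flipped p m b
      mono (inj₁ (m∈D , mp)) = inj₁ (m∈D , p′⊆p _ mp)
      mono (inj₂ (m∉D , mp)) = inj₂ (m∉D , p′⊆p _ mp)

    involution : Involution
    involution = record
      { e = e
      ; e∈M = proj₁ (proj₂ flip-graph)
      ; total = λ p∈ → let (q , cq , fl) = flip (to condition p∈) in
          q , from ∈-flip (p∈ , from condition cq , fl)
      ; symmetric = λ {p} {q} pq → let (p∈ , q∈ , fl) = to ∈-flip pq in
          from ∈-flip (q∈ , p∈ , flip-symmetric {p} {q} fl)
      ; domain = λ pq → proj₁ (to ∈-flip pq)
      ; monotone = λ {p} {p′} {q} {q′} pq p′q′ p≤p′ →
          let (_ , q∈ , fl) = to ∈-flip pq ; (_ , q′∈ , fl′) = to ∈-flip p′q′ in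
          from extends (q∈ , q′∈ , flip-monotone {p} {p′} {q} {q′} q′∈ fl fl′ (proj₂ (proj₂ (to extends p≤p′))))
      }

-- Homogeneity below `c₀`, avoidance of reals, and the atom

module Counterexample (em : ∀ {ℓ} → ExcludedMiddle ℓ) {M : V} (𝓜 : Model M) where
  open Model 𝓜
  open ClosureProperties 𝓜
  open Forcing 𝓜
  open Poset ℙ
  open Criterion em 𝓜 ℙ ℙ∈M
  open Symmetry em 𝓜
  open Category em {M} M-countable ℙ using (meet; up)
  open Generic using (filter; isFilter)
  open IsFilter using (subset; nonempty)

  c₀ : V
  c₀ = singleton (point 0 false)

  c₀∈ : c₀ ∈ carrier
  c₀∈ = from condition (singleton-condition 0 false)

  0∉-below : ∀ {p} → p ≤ c₀ → ¬ point 0 true ∈ p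
  0∉-below p≤c₀ with to extends p≤c₀
  ... | p∈ , _ , c₀⊆p with to condition p∈
  ... | _ , _ , excl , _ = excl 0 false (c₀⊆p (point 0 false) (elem∈ c₀ true))

  private
    Disagree : V → V → ℕ → Bool → Set
    Disagree p q m b = (point m b ∈ p × point m (not b) ∈ q) ⊎ (point m b ∈ q × point m (not b) ∈ p)

    disagreement : ∀ {p q} → Condition p → Condition q → ∃[ D ] D ∈ M × (∃[ d ] Bounded d D) ×
                   (∀ m b → point m b ∈ D ⇔ Disagree p q m b)
    disagreement {p} {q} (p∈M , (m , bp) , _) (q∈M , (n , bq) , _)
      with comprehend disagreeᶠ disagree-sep (p ∷ q ∷ []) (p∈M ∷ᴹ q∈M ∷ᴹ []ᴹ) (p ∪ q) (∪∈M p∈M q∈M)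
    ... | D , D∈M , D⇔ = D , D∈M ,
      (m ℕ.⊔ n , λ x x∈D → ∪-bounded p q bp bq x (proj₁ (to (D⇔ x) x∈D))) , λ k b → mk⇔
      (λ kD → forth k b (proj₂ (to (D⇔ (point k b)) kD)))
      (λ dis → from (D⇔ (point k b)) (member k b dis , back k b dis))
      where
      partner-in : ∀ {n} r → Bounded n r → ∀ k b → ∃[ y ] y ∈ r ×
                   (Lift _ (y ≈ ⟨ point k b , point k b ⟩) ⊎ Lift _ (point k b ≈ ⟨ y , y ⟩)) →
                   point k (not b) ∈ r
      partner-in r br k b (y , y∈r , partner) with br y y∈r
      ... | j , _ , c , y≈
        with point-partner {k} {j} b c (Partner-resp (≈-refl) y≈
               (Data.Sum.Base.map Lift.lower Lift.lower partner))
      ... | refl , refl = ∈-respˡ r y≈ y∈r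

      has-partner : ∀ k b → Lift _ (point k (not b) ≈ ⟨ point k b , point k b ⟩) ⊎
                            Lift _ (point k b ≈ ⟨ point k (not b) , point k (not b) ⟩)
      has-partner k b = Data.Sum.Base.map lift lift (partner-point k b)

      forth : ∀ k b → Sem M disagreeᶠ (point k b ∷ p ∷ q ∷ []) → Disagree p q k b
      forth k b (inj₁ (lift kp , y)) = inj₁ (kp , partner-in q bq k b y)
      forth k b (inj₂ (lift kq , y)) = inj₂ (kq , partner-in p bp k b y)

      back : ∀ k b → Disagree p q k b → Sem M disagreeᶠ (point k b ∷ p ∷ q ∷ [])
      back k b (inj₁ (kp , kq)) = inj₁ (lift kp , point k (not b) , kq , has-partner k b)
      back k b (inj₂ (kq , kp)) = inj₂ (lift kq , point k (not b) , kp , has-partner k b)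

      member : ∀ k b → Disagree p q k b → point k b ∈ p ∪ q
      member k b (inj₁ (kp , _)) = ∪ˡ q kp
      member k b (inj₂ (kq , _)) = ∪ʳ p kq

  -- Flip p at the bits where it disagrees with q; the union of the result with q is then a
  -- condition. Below `c₀` both have bit 0 equal to 0, so bit 0 is not among the flipped ones.
  homogeneous : ∀ {p q} → p ≤ c₀ → q ≤ c₀ →
    Σ[ ε ∈ Involution ] ∃[ s ] ⟨ p , s ⟩ ∈ Involution.e ε × Compatible s q
  homogeneous {p} {q} p≤c₀ q≤c₀ =
    let p∈ = proj₁ (to extends p≤c₀) ; q∈ = proj₁ (to extends q≤c₀)
        cp = to condition p∈ ; cq = to condition q∈
        (D , D∈M , (d , bD) , D⇔) = disagreement cp cq
    in flip-disagreement cp cq (0∉-below p≤c₀) (0∉-below q≤c₀) D∈M bD D⇔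
    where
    module _ (cp : Condition p) (cq : Condition q)
      (0∉p : ¬ point 0 true ∈ p) (0∉q : ¬ point 0 true ∈ q)
      {D} (D∈M : D ∈ M) {d} (bD : Bounded d D)
      (D⇔ : ∀ m b → point m b ∈ D ⇔ Disagree p q m b) where

      closed : ∀ m b → point m b ∈ D → point m (not b) ∈ D
      closed m b mD = from (D⇔ m (not b)) (swap (to (D⇔ m b) mD))
        where
        swap : Disagree p q m b → Disagree p q m (not b)
        swap (inj₁ (mp , mq)) = inj₂ (mq , subst (λ b → point m b ∈ p) (sym (not-involutive b)) mp)
        swap (inj₂ (mq , mp)) = inj₁ (mp , subst (λ b → point m b ∈ q) (sym (not-involutive b)) mq)

      0∉D : ∀ b → ¬ point 0 b ∈ D
      0∉D b 0D = agree b (to (D⇔ 0 b) 0D)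
        where
        agree : ∀ b → ¬ Disagree p q 0 b
        agree true (inj₁ (0p , _)) = 0∉p 0p
        agree true (inj₂ (0q , _)) = 0∉q 0q
        agree false (inj₁ (_ , 0q)) = 0∉q 0q
        agree false (inj₂ (_ , 0p)) = 0∉p 0p

      open Flip D∈M bD closed 0∉D

      -- Off D a clash with q would be a disagreement, hence in D. On D the opposite value lies in
      -- both p and q, while b itself lies in one of them, which is inconsistent.
      agrees : ∀ {s} → IsFlip p s → ∀ m b → point m b ∈ s → ¬ point m (not b) ∈ q
      agrees fl m b ms mq with to (fl m b) ms
      ... | inj₂ (m∉D , mp) = m∉D (from (D⇔ m b) (inj₁ (mp , mq)))
      ... | inj₁ (m∈D , mp) with to (D⇔ m b) m∈D
      ...   | inj₁ (mp′ , _) = proj₁ (proj₂ (proj₂ cp)) m b mp′ mp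
      ...   | inj₂ (mq′ , _) = proj₁ (proj₂ (proj₂ cq)) m b mq′ mq

      0∉flip : ∀ {s} → IsFlip p s → ¬ point 0 true ∈ s
      0∉flip fl 0s with to (fl 0 true) 0s
      ... | inj₁ (0D , _) = 0∉D true 0D
      ... | inj₂ (_ , 0p) = 0∉p 0p

      flip-disagreement : Σ[ ε ∈ Involution ] ∃[ s ] ⟨ p , s ⟩ ∈ Involution.e ε × Compatible s q
      flip-disagreement =
        let (s , cs , fl) = flip cp
            s∈ = from condition cs ; q∈ = from condition cq
            r∈ = from condition (∪-condition {s} {q} cs cq (agrees {s} fl) (0∉flip {s} fl) 0∉q)
        in involution , s , from ∈-flip (from condition cp , s∈ , fl) ,
           s ∪ q , r∈ , from extends (r∈ , s∈ , λ z → ∪ˡ q) , from extends (r∈ , q∈ , λ z → ∪ʳ s)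

  extend-≤ : ∀ {p} → p ∈ carrier → ¬ point 0 true ∈ p →
             ∃[ n ] (∀ b → ¬ point n b ∈ p) × (∀ b → p ∪ singleton (point n b) ≤ p)
  extend-≤ {p} p∈ 0∉p with to condition p∈
  ... | cp@(_ , (n , bounded) , _) = suc n , (λ b → fresh {n} {suc n} {b} {p} bounded (n≤1+n n)) ,
    λ b → from extends (from condition (extend b cp bounded 0∉p) , p∈ , λ z → ∪ˡ (singleton (point (suc n) b)))

  private
    union-name = Names.Check.union-name 𝓜 carrier∈M

    τ = proj₁ union-name

  val-τ : ∀ (H : Generic M ℙ) → val (filter H) τ ≈ ⋃ᵛ filter H
  val-τ H = proj₂ (proj₂ union-name) (subset (isFilter H)) (nonempty (isFilter H))

  ⋃-exclusive : ∀ (H : Generic M ℙ) m b → point m b ∈ ⋃ᵛ filter H → ¬ point m (not b) ∈ ⋃ᵛ filter H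
  ⋃-exclusive H m b mH mH′ with to (∈-⋃ (filter H)) mH | to (∈-⋃ (filter H)) mH′
  ... | p , p∈H , mp | q , q∈H , mq with meet H p∈H q∈H
  ... | r , r∈H , r≤p , r≤q with to extends r≤p | to extends r≤q
  ... | r∈ , _ , p⊆r | _ , _ , q⊆r =
    proj₁ (proj₂ (proj₂ (to condition r∈))) m b (p⊆r (point m b) mp) (q⊆r (point m (not b)) mq)

  -- Diagonalise at one fresh bit: it is set to 0 if y contains the point for 1, and to 1 otherwise.
  avoid : ∀ y {p} → p ≤ c₀ → ∃[ q ] q ≤ p × (∀ (H : Generic M ℙ) → q ∈ filter H → ¬ val (filter H) τ ≈ y)
  avoid y {p} p≤c₀ with extend-≤ (proj₁ (to extends p≤c₀)) (0∉-below p≤c₀)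
  ... | n , _ , extended with em {P = point n true ∈ y}
  ...   | yes n∈y = p ∪ singleton (point n false) , extended false , λ H q∈H e →
    ⋃-exclusive H n false
      (from (∈-⋃ (filter H)) (_ , q∈H , ∪ʳ p (elem∈ (singleton (point n false)) true)))
      (≈⇒⊆ (≈-trans (≈-sym e) (val-τ H)) (point n true) n∈y)
  ...   | no n∉y = p ∪ singleton (point n true) , extended true , λ H q∈H e →
    n∉y (≈⇒⊆ (≈-trans (≈-sym (val-τ H)) e) (point n true)
      (from (∈-⋃ (filter H)) (_ , q∈H , ∪ʳ p (elem∈ (singleton (point n true)) true))))

  not-smooth : ¬ Smooth (Gen M ℙ) (GenOpen M ℙ) (SameExtension M ℙ)
  not-smooth smooth =
    let (U , baire , invariant , separates) = smooth⇒separating-family em M-countable ℙ smooth in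
    ergodic-family c₀∈ homogeneous (proj₁ (proj₂ union-name)) avoid U baire invariant
      λ G H _ _ → separates G H

  -- { 0 } is an atom, but nothing below { 1 } is.
  not-weakly-homogeneous : ¬ WeaklyHomogeneousIn M ℙ
  not-weakly-homogeneous wh = go (wh atom branch atom∈ branch∈)
    where
    atom branch : V
    atom = singleton (point 0 true)
    branch = singleton (point 1 true)

    atom∈ : atom ∈ carrier
    atom∈ = from condition (singleton-condition 0 true)

    branch∈ : branch ∈ carrier
    branch∈ = from condition (singleton-condition 1 true)

    ≤atom⇒≈ : ∀ {p} → p ≤ atom → p ≈ atom
    ≤atom⇒≈ {p} p≤ with to extends p≤
    ... | p∈ , _ , atom⊆p with to condition p∈
    ... | _ , (n , bounded) , _ , atomic = ≈-ext
      (λ z z∈p → let (m , _ , b , z≈) = bounded z z∈p in point-in z z≈ (atomic 0p m b (∈-respˡ p z≈ z∈p)))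
      atom⊆p
      where
      0p : point 0 true ∈ p
      0p = atom⊆p (point 0 true) (elem∈ atom true)
      point-in : ∀ z {m b} → z ≈ point m b → m ≡ 0 × b ≡ true → z ∈ atom
      point-in z z≈ (refl , refl) = true , z≈

    go : ¬ (∃[ e ] e ∈ M × IsAutomorphism e × (∃[ a ] ⟨ atom , a ⟩ ∈ e × Compatible a branch))
    go (e , _ , auto , a , atom-a , r , r∈ , r≤a , r≤branch) = n∉r true (r′⊆r _ (∪ʳ r (elem∈ (singleton (point n true)) true)))
      where
      open IsAutomorphism auto

      -- r contains the point of bit 1, with which the atom's point conflicts; hence r can be
      -- extended properly.
      0∉r : ¬ point 0 true ∈ r
      0∉r 0r with proj₂ (proj₂ (proj₂ (to condition r∈))) 0r 1 true
                    (proj₂ (proj₂ (to extends r≤branch)) (point 1 true) (elem∈ branch true))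
      ... | () , _

      n = proj₁ (extend-≤ r∈ 0∉r)
      n∉r = proj₁ (proj₂ (extend-≤ r∈ 0∉r))

      r′ : V
      r′ = r ∪ singleton (point n true)

      r′≤r : r′ ≤ r
      r′≤r = proj₂ (proj₂ (extend-≤ r∈ 0∉r)) true

      r′≤a : r′ ≤ a
      r′≤a = ≤-trans r′ r a r′≤r r≤a

      preimage = surjective r′ (proj₁ (to extends r′≤a))

      a≈r′ : a ≈ r′
      -- The preimage of r′ ≤ a lies below `atom`, hence equals it, so r′ is the image a of the
      -- atom. As r ≤ a, the fresh point of r′ would then already be in r.
      a≈r′ = functional atom a r′ atom-a
        (⟨⟩∈-resp e (≤atom⇒≈ (from (monotone _ atom r′ a (proj₂ preimage) atom-a) r′≤a)) ≈-refl
          (proj₂ preimage))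

      r′⊆r : r′ ⊆ r
      r′⊆r z z∈ = proj₂ (proj₂ (to extends r≤a)) z (≈⇒⊇ a≈r′ z z∈)

proposition3p4 : (∀ {ℓ} → ExcludedMiddle ℓ) →
    Σ[ Γ ∈ List Sentence ] All ZFC Γ ×
    (∀ (M : V) → Transitive M → Countable M → All (M ⊨_) Γ →
    Σ[ ℙ ∈ Poset ]
    (Poset.asSet ℙ ∈ M) ×
    (¬ WeaklyHomogeneousIn M ℙ) ×
    (¬ Smooth (Gen M ℙ) (GenOpen M ℙ) (SameExtension M ℙ)))
proposition3p4 em = Γ , Γ-ZFC , λ M transitive countable sat →
  let 𝓜 = model transitive countable sat in
  Forcing.ℙ 𝓜 , Forcing.ℙ∈M 𝓜 ,
  Counterexample.not-weakly-homogeneous em 𝓜 , Counterexample.not-smooth em 𝓜
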